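{- Let $P$ be a level poset with underlying digraph on the vertex set $V$, and let $x,y\in V$. Then the $\mathbf{a}\mathbf{b}$-series $\Psi_{x,y}$ of $P$ is a rational generating function in the non-commutative variables $\mathbf{a}$ and $\mathbf{b}$.
   Context: Level poset: let $M$ be a $0/1$ square matrix with rows and columns indexed by a finite nonempty set $V$. The level poset of $M$ is the poset on $V\times\mathbb{Z}$ with $(u,i)<(v,j)$ if and only if $i<j$ and $(M^{j-i})_{u,v}>0$; the second coordinate is its rank function. $\mathbf{a}\mathbf{b}$-index: for a finite graded poset $Q$ of rank $m+1$ with minimum $\hat0$, maximum $\hat1$ and rank function $\rho$, and a chain $c=\{\hat0=x_0<x_1<\cdots<x_{k+1}=\hat1\}$, put $$\operatorname{wt}(c)=(\mathbf{a}-\mathbf{b})^{\rho(x_0,x_1)-1}\cdot\mathbf{b}\cdot(\mathbf{a}-\mathbf{b})^{\rho(x_1,x_2)-1}\cdot\mathbf{b}\cdots\mathbf{b}\cdot(\mathbf{a}-\mathbf{b})^{\rho(x_k,x_{k+1})-1},$$ where $\rho(x,y)=\rho(y)-\rho(x)$ and $\mathbf{a},\mathbf{b}$ are non-commuting variables of degree one. Then $\Psi(Q)=\sum_c\operatorname{wt}(c)$, summed over all chains $c$ containing $\hat0$ and $\hat1$; it is homogeneous of degree $m$. $\mathbf{a}\mathbf{b}$-series: $\Psi_{x,y}=\sum_{m\ge0}\Psi([(x,0),(y,m+1)])\in\mathbb{R}\langle\langle\mathbf{a},\mathbf{b}\rangle\rangle$, where $\Psi([(x,0),(y,m+1)])$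 is taken to be $0$ if $(x,0)\not\le(y,m+1)$. A non-commutative formal power series is rational if it belongs to the smallest set of series containing all non-commutative polynomials and closed under sums, products, and inverses of series with nonzero constant term. -}

module Defs where

open import Algebra.Apartness.Bundles using (HeytingField)
open import Data.Empty using (⊥-elim)
open import Data.Fin.Base using (Fin) renaming (zero to fzero; suc to fsuc)
import Data.Fin.Properties as Fin
open import Data.Integer.Base as ℤ using (ℤ; +_; +[1+_]; 0ℤ; 1ℤ; ∣_∣)
import Data.Integer.Properties as ℤ
open import Data.List.Base
  using (List; []; _∷_; [_]; _++_; map; filter; foldr; zipWith; inits; tails; length;
         upTo; allFin; concatMap; cartesianProduct; cartesianProductWith)
open import Data.List.Membership.Propositional using (_∈_; _∉_)
open import Data.List.Membership.Propositional.Properties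
open import Data.List.Properties using (length-++)
open import Data.List.Relation.Unary.All as All using (All; []; _∷_)
import Data.List.Relation.Unary.All.Properties as All
open import Data.List.Relation.Unary.Linked using (Linked; linked?; [-]; _∷_)
open import Data.List.Relation.Unary.Unique.Propositional using (Unique)
import Data.List.Relation.Unary.Unique.Propositional.Properties as Unique
open import Data.Nat.Base as ℕ using (ℕ; zero; suc; _∸_; z≤n; s≤s; z<s)
import Data.Nat.Properties as ℕ
open import Data.Product.Base using (∃-syntax; _×_; _,_; proj₁; proj₂)
import Data.Product.Properties as Product
open import Data.Sum.Base using (_⊎_; inj₁; inj₂)
open import Function.Base using (_∘_)
open import Level using (_⊔_)
open import Relation.Binary.Construct.StrictToNonStrict using (<-≤-trans; ≤-<-trans)
  renaming (_≤_ to ReflClosure; decidable to reflClosure?)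
open import Relation.Binary.Definitions using (Decidable)
open import Relation.Binary.PropositionalEquality
  using (_≡_; _≢_; refl; sym; trans; cong; subst; isEquivalence; resp₂; module ≡-Reasoning)
open import Relation.Binary.Structures using (IsStrictPartialOrder)
open import Relation.Nullary using (¬_; Dec; yes; no)
open import Relation.Nullary.Decidable using (_×-dec_)
open import Algebra.Properties.Semiring.Sum ℕ.+-*-semiring using (sum)

module _ where
  open ≡-Reasoning

  ∣i+k-i∣ : ∀ i k → ∣ (i ℤ.+ + k) ℤ.- i ∣ ≡ k
  ∣i+k-i∣ i k = cong ∣_∣ (begin
    (i ℤ.+ + k) ℤ.- i   ≡⟨ cong (ℤ._- i) (ℤ.+-comm i (+ k)) ⟩
    (+ k ℤ.+ i) ℤ.- i   ≡⟨ ℤ.+-assoc (+ k) i (ℤ.- i) ⟩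
    + k ℤ.+ (i ℤ.- i)   ≡⟨ cong (λ z → + k ℤ.+ z) (ℤ.+-inverseʳ i) ⟩
    + k ℤ.+ 0ℤ          ≡⟨ ℤ.+-identityʳ (+ k) ⟩
    + k                 ∎)

  <⇒+ : ∀ {i j} → i ℤ.< j → ∃[ k ] j ≡ i ℤ.+ +[1+ k ]
  <⇒+ {i} {j} i<j = go (j ℤ.- i) refl (ℤ.i≤j⇒0≤j-i (ℤ.<⇒≤ i<j))
    where
    j≡i+ : ∀ d → j ℤ.- i ≡ d → j ≡ i ℤ.+ d
    j≡i+ d eq = begin
      j                   ≡⟨ ℤ.+-identityʳ j ⟨
      j ℤ.+ 0ℤ            ≡⟨ cong (λ z → j ℤ.+ z) (ℤ.+-inverseˡ i) ⟨
      j ℤ.+ (ℤ.- i ℤ.+ i) ≡⟨ ℤ.+-assoc j (ℤ.- i) i ⟨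
      (j ℤ.- i) ℤ.+ i     ≡⟨ cong (ℤ._+ i) eq ⟩
      d ℤ.+ i             ≡⟨ ℤ.+-comm d i ⟩
      i ℤ.+ d             ∎
    go : ∀ d → j ℤ.- i ≡ d → 0ℤ ℤ.≤ d → ∃[ k ] j ≡ i ℤ.+ +[1+ k ]
    go +[1+ k ] eq _ = k , j≡i+ _ eq
    go (+ zero) eq _ =
      ⊥-elim (ℤ.<-irrefl (sym (trans (j≡i+ _ eq) (ℤ.+-identityʳ i))) i<j)

------------------------------------------------------------------------
-- Finite graded posets

-- The underlying set of the poset is the set of members of the
-- duplicate-free list `elements`, ordered by the restriction of an
-- ambient order `_<_`; `Carrier` itself may be infinite.
record FiniteGradedPoset (m : ℕ) : Set₁ where
  infix 4 _<_
  field
    Carrier              : Set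
    _<_                  : Carrier → Carrier → Set
    isStrictPartialOrder : IsStrictPartialOrder _≡_ _<_
    _<?_                 : Decidable _<_
    elements             : List Carrier
    unique               : Unique elements
    0̂ 1̂                  : Carrier
    0̂∈                   : 0̂ ∈ elements
    1̂∈                   : 1̂ ∈ elements

  infix 4 _≤_
  _≤_ : Carrier → Carrier → Set
  _≤_ = ReflClosure _≡_ _<_

  field
    minimum : ∀ {p} → p ∈ elements → 0̂ ≤ p
    maximum : ∀ {p} → p ∈ elements → p ≤ 1̂
    ρ       : Carrier → ℤ
    ρ-0̂     : ρ 0̂ ≡ 0ℤ
    ρ-1̂     : ρ 1̂ ≡ +[1+ m ]
    ρ-mono  : ∀ {p q} → p ∈ elements → q ∈ elements → p < q → ρ p ℤ.< ρ q
    ρ-cover : ∀ {p q} → p ∈ elements → q ∈ elements → p < q →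
              (∀ {r} → r ∈ elements → p < r → ¬ r < q) →
              ρ q ≡ ℤ.suc (ρ p)

  -- The rank difference ρ(p,q); only used for p < q, where the absolute
  -- value is redundant.
  ρ[_,_] : Carrier → Carrier → ℕ
  ρ[ p , q ] = ∣ ρ q ℤ.- ρ p ∣

  -- A chain 0̂ = x₀ < x₁ < ⋯ < xₖ₊₁ = 1̂ is represented by the list
  -- x₁ , … , xₖ of its interior elements.
  IsChain : List Carrier → Set
  IsChain c = Linked _<_ (0̂ ∷ c ++ [ 1̂ ])

  isChain? : (c : List Carrier) → Dec (IsChain c)
  isChain? c = linked? _<?_ (0̂ ∷ c ++ [ 1̂ ])

  tuples : ℕ → List (List Carrier)
  tuples zero    = [ [] ]
  tuples (suc k) = cartesianProductWith _∷_ elements (tuples k)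

  -- Every chain occurs exactly once: the ranks of the interior elements
  -- are distinct and lie in {1, …, m}, so there are at most m of them.
  chains : List (List Carrier)
  chains = filter isChain? (concatMap tuples (upTo (suc m)))

------------------------------------------------------------------------
-- Level posets

Matrix : ℕ → Set
Matrix n = Fin n → Fin n → ℕ

IsZeroOne : ∀ {n} → Matrix n → Set
IsZeroOne M = ∀ u v → M u v ≡ 0 ⊎ M u v ≡ 1

identity : ∀ {n} → Matrix n
identity u v with u Fin.≟ v
... | yes _ = 1
... | no  _ = 0

infixl 7 _⊗_
_⊗_ : ∀ {n} → Matrix n → Matrix n → Matrix n
(A ⊗ B) u v = sum (λ t → A u t ℕ.* B t v)

infixr 8 _^_
_^_ : ∀ {n} → Matrix n → ℕ → Matrix n
M ^ zero  = identity
M ^ suc k = M ⊗ (M ^ k)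

module LevelPoset {n : ℕ} (M : Matrix n) where

  Element : Set
  Element = Fin n × ℤ

  infix 4 _<_ _≤_ _<?_ _≤?_

  -- Since i < j, the exponent ∣ j - i ∣ is j - i.
  _<_ : Element → Element → Set
  (u , i) < (v , j) = i ℤ.< j × 0 ℕ.< (M ^ ∣ j ℤ.- i ∣) u v

  _≤_ : Element → Element → Set
  _≤_ = ReflClosure _≡_ _<_

  _<?_ : Decidable _<_
  (u , i) <? (v , j) = (i ℤ.<? j) ×-dec (0 ℕ.<? (M ^ ∣ j ℤ.- i ∣) u v)

  _≤?_ : Decidable _≤_
  _≤?_ = reflClosure? _≡_ _<_ (Product.≡-dec Fin._≟_ ℤ._≟_) _<?_

  sum-pos : ∀ {k} (f : Fin k → ℕ) t → 0 ℕ.< f t → 0 ℕ.< sum f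
  sum-pos f fzero    p = ℕ.<-≤-trans p (ℕ.m≤m+n _ _)
  sum-pos f (fsuc t) p =
    ℕ.<-≤-trans (sum-pos (f ∘ fsuc) t p) (ℕ.m≤n+m _ (f fzero))

  sum-pos⁻ : ∀ {k} (f : Fin k → ℕ) → 0 ℕ.< sum f → ∃[ t ] 0 ℕ.< f t
  sum-pos⁻ {suc k} f p with f fzero in eq
  ... | suc _ = fzero , subst (0 ℕ.<_) (sym eq) z<s
  ... | zero  with t , q ← sum-pos⁻ (f ∘ fsuc) p = fsuc t , q

  *-pos⁻ : ∀ a b → 0 ℕ.< a ℕ.* b → 0 ℕ.< a × 0 ℕ.< b
  *-pos⁻ (suc a) (suc b) p = z<s , z<s
  *-pos⁻ (suc a) zero    p = ⊥-elim (ℕ.<-irrefl (sym (ℕ.*-zeroʳ a)) p)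

  ^-step⁻ : ∀ k {u v} → 0 ℕ.< (M ^ suc k) u v →
            ∃[ t ] 0 ℕ.< M u t × 0 ℕ.< (M ^ k) t v
  ^-step⁻ k p with t , q ← sum-pos⁻ _ p = t , *-pos⁻ _ _ q

  ^-step : ∀ k {u v} t → 0 ℕ.< M u t → 0 ℕ.< (M ^ k) t v →
           0 ℕ.< (M ^ suc k) u v
  ^-step k t p q = sum-pos _ t (ℕ.*-mono-< p q)

  ^-zero⁻ : ∀ {u v} → 0 ℕ.< (M ^ 0) u v → u ≡ v
  ^-zero⁻ {u} {v} p with u Fin.≟ v
  ... | yes u≡v = u≡v

  ^-one : ∀ {u v} → 0 ℕ.< M u v → 0 ℕ.< (M ^ 1) u v
  ^-one {u} {v} p = ^-step 0 v p id-pos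
    where
    id-pos : 0 ℕ.< (M ^ 0) v v
    id-pos with v Fin.≟ v
    ... | yes _  = z<s
    ... | no v≢v = ⊥-elim (v≢v refl)

  ^-trans : ∀ k l {u v w} → 0 ℕ.< (M ^ k) u v → 0 ℕ.< (M ^ l) v w →
            0 ℕ.< (M ^ (k ℕ.+ l)) u w
  ^-trans zero    l p q with refl ← ^-zero⁻ p = q
  ^-trans (suc k) l p q with t , p₁ , p₂ ← ^-step⁻ k p =
    ^-step (k ℕ.+ l) t p₁ (^-trans k l p₂ q)

  isStrictPartialOrder : IsStrictPartialOrder _≡_ _<_
  isStrictPartialOrder = record
    { isEquivalence = isEquivalence
    ; irrefl        = λ { refl (i<i , _) → ℤ.<-irrefl refl i<i }
    ; trans         = <-trans
    ; <-resp-≈      = resp₂ _<_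
    }
    where
    <-trans : ∀ {p q r} → p < q → q < r → p < r
    <-trans {u , i} {v , j} {w , l} (i<j , p) (j<l , q)
      with a , refl ← <⇒+ i<j
      with b , refl ← <⇒+ j<l
      = ℤ.<-trans i<j j<l
      , subst (λ k → 0 ℕ.< (M ^ k) u w) (sym eq)
          (^-trans (suc a) (suc b)
            (subst (λ k → 0 ℕ.< (M ^ k) u v) (∣i+k-i∣ i (suc a)) p)
            (subst (λ k → 0 ℕ.< (M ^ k) v w) (∣i+k-i∣ (i ℤ.+ + suc a) (suc b)) q))
      where
      eq : ∣ (i ℤ.+ + suc a ℤ.+ + suc b) ℤ.- i ∣ ≡ suc a ℕ.+ suc b
      eq = trans (cong (λ z → ∣ z ℤ.- i ∣) (ℤ.+-assoc i (+ suc a) (+ suc b)))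
                 (∣i+k-i∣ i (suc a ℕ.+ suc b))

  module <-Order = IsStrictPartialOrder isStrictPartialOrder

  <-≤-tr : ∀ {p q r} → p < q → q ≤ r → p < r
  <-≤-tr = <-≤-trans _≡_ _<_ <-Order.trans <-Order.<-respʳ-≈

  ≤-<-tr : ∀ {p q r} → p ≤ q → q < r → p < r
  ≤-<-tr = ≤-<-trans _≡_ _<_ sym <-Order.trans <-Order.<-respˡ-≈

  -- A relation that is not a cover has an element one level above its
  -- bottom strictly in between.
  cover-rank : ∀ {p q} → p < q → (∀ {r} → p < r → ¬ r < q) →
               proj₂ q ≡ ℤ.suc (proj₂ p)
  cover-rank {u , i} {v , j} (i<j , p) cover with <⇒+ i<j
  ... | zero  , refl = ℤ.+-comm i 1ℤ
  ... | suc k , refl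
    with t , p₁ , p₂ ← ^-step⁻ (suc k)
           (subst (λ l → 0 ℕ.< (M ^ l) u v) (∣i+k-i∣ i (suc (suc k))) p)
    = ⊥-elim (cover {t , i ℤ.+ 1ℤ}
        (up i 0 , subst (λ l → 0 ℕ.< (M ^ l) u t) (sym (∣i+k-i∣ i 1)) (^-one p₁))
        ( subst (i ℤ.+ 1ℤ ℤ.<_) shift (up (i ℤ.+ 1ℤ) k)
        , subst (λ l → 0 ℕ.< (M ^ l) t v)
            (sym (trans (cong (λ z → ∣ z ℤ.- (i ℤ.+ 1ℤ) ∣) (sym shift))
                        (∣i+k-i∣ (i ℤ.+ 1ℤ) (suc k))))
            p₂))
    where
    up : ∀ a l → a ℤ.< a ℤ.+ + suc l
    up a l = subst (ℤ._< a ℤ.+ + suc l) (ℤ.+-identityʳ a)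
               (ℤ.+-monoʳ-< a (ℤ.+<+ z<s))
    shift : i ℤ.+ 1ℤ ℤ.+ + suc k ≡ i ℤ.+ + suc (suc k)
    shift = ℤ.+-assoc i 1ℤ (+ suc k)

  module _ (x y : Fin n) (m : ℕ) where

    bottom top : Element
    bottom = x , 0ℤ
    top    = y , +[1+ m ]

    between? : (p : Element) → Dec (bottom ≤ p × p ≤ top)
    between? p = (bottom ≤? p) ×-dec (p ≤? top)

    candidates : List Element
    candidates = cartesianProduct (allFin n) (map +_ (upTo (suc (suc m))))

    intervalElements : List Element
    intervalElements = filter between? candidates

    ∈-interval⁺ : ∀ {p} → bottom ≤ p → p ≤ top → p ∈ intervalElements
    ∈-interval⁺ {u , i} b≤p p≤t =
      ∈-filter⁺ between? (∈-cartesianProduct⁺ (∈-allFin u) (level i (lower b≤p) (upper p≤t)))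
        (b≤p , p≤t)
      where
      lower : ∀ {u i} → bottom ≤ (u , i) → 0ℤ ℤ.≤ i
      lower (inj₁ (0<i , _)) = ℤ.<⇒≤ 0<i
      lower (inj₂ refl)      = ℤ.≤-refl
      upper : ∀ {u i} → (u , i) ≤ top → i ℤ.≤ +[1+ m ]
      upper (inj₁ (i<t , _)) = ℤ.<⇒≤ i<t
      upper (inj₂ refl)      = ℤ.≤-refl
      level : ∀ i → 0ℤ ℤ.≤ i → i ℤ.≤ +[1+ m ] → i ∈ map +_ (upTo (suc (suc m)))
      level (+ k) _ (ℤ.+≤+ k≤) = ∈-map⁺ +_ (∈-upTo⁺ (s≤s k≤))

    ∈-interval⁻ : ∀ {p} → p ∈ intervalElements → bottom ≤ p × p ≤ top
    ∈-interval⁻ p∈ = proj₂ (∈-filter⁻ between? {xs = candidates} p∈)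

    interval : bottom < top → FiniteGradedPoset m
    interval b<t = record
      { Carrier              = Element
      ; _<_                  = _<_
      ; isStrictPartialOrder = isStrictPartialOrder
      ; _<?_                 = _<?_
      ; elements             = intervalElements
      ; unique               = Unique.filter⁺ between?
          (Unique.cartesianProduct⁺ (Unique.allFin⁺ n)
            (Unique.map⁺ ℤ.+-injective (Unique.upTo⁺ (suc (suc m)))))
      ; 0̂                    = bottom
      ; 1̂                    = top
      ; 0̂∈                   = ∈-interval⁺ (inj₂ refl) (inj₁ b<t)
      ; 1̂∈                   = ∈-interval⁺ (inj₁ b<t) (inj₂ refl)
      ; minimum              = λ p∈ → proj₁ (∈-interval⁻ p∈)
      ; maximum              = λ p∈ → proj₂ (∈-interval⁻ p∈)
      ; ρ                    = proj₂
      ; ρ-0̂                  = refl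
      ; ρ-1̂                  = refl
      ; ρ-mono               = λ _ _ → proj₁
      ; ρ-cover              = λ p∈ q∈ p<q cover → cover-rank p<q λ p<r r<q →
          cover (∈-interval⁺ (inj₁ (≤-<-tr (proj₁ (∈-interval⁻ p∈)) p<r))
                             (inj₁ (<-≤-tr r<q (proj₂ (∈-interval⁻ q∈)))))
                p<r r<q
      }

------------------------------------------------------------------------
-- Non-commutative formal power series in 𝐚 and 𝐛

data Letter : Set where
  𝐚 𝐛 : Letter

Word : Set
Word = List Letter

-- The coefficients lie in an arbitrary field, in particular in any model
-- of the real numbers.
module PowerSeries {c ℓ₁ ℓ₂} (K : HeytingField c ℓ₁ ℓ₂) where
  open HeytingField K
    using (_≈_; _#_; 0#; 1#; +-cong; *-cong; zeroˡ; zeroʳ; +-identityˡ; -‿inverseʳ)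
    renaming (refl to ≈-refl; trans to ≈-trans;
      Carrier to 𝕂; _+_ to _+ᴷ_; _*_ to _*ᴷ_; -_ to -ᴷ_)

  Series : Set c
  Series = Word → 𝕂

  infix 4 _≋_
  _≋_ : Series → Series → Set ℓ₁
  f ≋ g = ∀ w → f w ≈ g w

  sumᴷ : List 𝕂 → 𝕂
  sumᴷ = foldr _+ᴷ_ 0#

  infixl 6 _⊕_ _⊖_
  infixl 7 _⊙_

  _⊕_ _⊖_ _⊙_ : Series → Series → Series
  (f ⊕ g) w = f w +ᴷ g w
  (f ⊖ g) w = f w +ᴷ (-ᴷ g w)
  -- The sum over all factorizations w = uv.
  (f ⊙ g) w = sumᴷ (zipWith (λ u v → f u *ᴷ g v) (inits w) (tails w))

  𝟘 𝟙 : Series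
  𝟘 _       = 0#
  𝟙 []      = 1#
  𝟙 (_ ∷ _) = 0#

  a b : Series
  a (𝐚 ∷ []) = 1#
  a _        = 0#
  b (𝐛 ∷ []) = 1#
  b _        = 0#

  infixr 8 _**_
  _**_ : Series → ℕ → Series
  f ** zero  = 𝟙
  f ** suc k = f ⊙ f ** k

  IsPolynomial : Series → Set ℓ₁
  IsPolynomial f = ∃[ support ] (∀ w → w ∉ support → f w ≈ 0#)

  IsInverse : Series → Series → Set ℓ₁
  IsInverse f g = f ⊙ g ≋ 𝟙 × g ⊙ f ≋ 𝟙

  -- In a Heyting field `x # 0#` is the positive form of x ≠ 0: it holds
  -- exactly when x is invertible.  `respects` says that this is a set of
  -- series up to coefficientwise equality.
  data IsRational : Series → Set (c ⊔ ℓ₁ ⊔ ℓ₂) where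
    polynomial : ∀ {f} → IsPolynomial f → IsRational f
    plus       : ∀ {f g} → IsRational f → IsRational g → IsRational (f ⊕ g)
    times      : ∀ {f g} → IsRational f → IsRational g → IsRational (f ⊙ g)
    inverse    : ∀ {f g} → IsRational f → f [] # 0# → IsInverse f g → IsRational g
    respects   : ∀ {f g} → f ≋ g → IsRational f → IsRational g

  Homogeneous : ℕ → Series → Set ℓ₁
  Homogeneous d f = ∀ w → length w ≢ d → f w ≈ 0#

  0+0 : ∀ {p q} → p ≈ 0# → q ≈ 0# → p +ᴷ q ≈ 0#
  0+0 p q = ≈-trans (+-cong p q) (+-identityˡ 0#)

  sumᴷ-zero : ∀ {A : Set} (f : A → 𝕂) xs → All (λ z → f z ≈ 0#) xs →
              sumᴷ (map f xs) ≈ 0#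
  sumᴷ-zero f []       []       = ≈-refl
  sumᴷ-zero f (_ ∷ xs) (p ∷ ps) = 0+0 p (sumᴷ-zero f xs ps)

  ⊙-∷ : ∀ f g l w → (f ⊙ g) (l ∷ w) ≡
        f [] *ᴷ g (l ∷ w) +ᴷ ((λ u → f (l ∷ u)) ⊙ g) w
  ⊙-∷ f g l w = cong (λ zs → f [] *ᴷ g (l ∷ w) +ᴷ sumᴷ zs)
    (zipWith-mapˡ (inits w) (tails w))
    where
    zipWith-mapˡ : ∀ us vs → zipWith (λ u v → f u *ᴷ g v) (map (l ∷_) us) vs ≡
                             zipWith (λ u v → f (l ∷ u) *ᴷ g v) us vs
    zipWith-mapˡ []       _        = refl
    zipWith-mapˡ (_ ∷ _)  []       = refl
    zipWith-mapˡ (u ∷ us) (v ∷ vs) = cong (_ ∷_) (zipWith-mapˡ us vs)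

  ⊙-zero : ∀ f g w → (∀ u v → u ++ v ≡ w → f u *ᴷ g v ≈ 0#) → (f ⊙ g) w ≈ 0#
  ⊙-zero f g []      h = 0+0 (h [] [] refl) ≈-refl
  ⊙-zero f g (l ∷ w) h rewrite ⊙-∷ f g l w =
    0+0 (h [] (l ∷ w) refl)
        (⊙-zero (λ u → f (l ∷ u)) g w λ u v eq → h (l ∷ u) v (cong (l ∷_) eq))

  ⊙-homogeneous : ∀ {d e f g} → Homogeneous d f → Homogeneous e g →
                  Homogeneous (d ℕ.+ e) (f ⊙ g)
  ⊙-homogeneous {d} {e} {f} {g} hf hg w ≢d+e = ⊙-zero f g w vanish
    where
    vanish : ∀ u v → u ++ v ≡ w → f u *ᴷ g v ≈ 0#
    vanish u v refl with length u ℕ.≟ d | length v ℕ.≟ e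
    ... | no ≢d    | _        = ≈-trans (*-cong (hf u ≢d) ≈-refl) (zeroˡ _)
    ... | yes _    | no ≢e    = ≈-trans (*-cong ≈-refl (hg v ≢e)) (zeroʳ _)
    ... | yes refl | yes refl = ⊥-elim (≢d+e (length-++ u))

  **-homogeneous : ∀ {f} → Homogeneous 1 f → ∀ k → Homogeneous k (f ** k)
  **-homogeneous hf zero    []      ≢0 = ⊥-elim (≢0 refl)
  **-homogeneous hf zero    (_ ∷ _) _  = ≈-refl
  **-homogeneous hf (suc k) = ⊙-homogeneous hf (**-homogeneous hf k)

  b-homogeneous : Homogeneous 1 b
  b-homogeneous []          _  = ≈-refl
  b-homogeneous (_ ∷ [])    ≢1 = ⊥-elim (≢1 refl)
  b-homogeneous (𝐚 ∷ _ ∷ _) _  = ≈-refl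
  b-homogeneous (𝐛 ∷ _ ∷ _) _  = ≈-refl

  a⊖b-homogeneous : Homogeneous 1 (a ⊖ b)
  a⊖b-homogeneous []          _  = -‿inverseʳ 0#
  a⊖b-homogeneous (_ ∷ [])    ≢1 = ⊥-elim (≢1 refl)
  a⊖b-homogeneous (𝐚 ∷ _ ∷ _) _  = -‿inverseʳ 0#
  a⊖b-homogeneous (𝐛 ∷ _ ∷ _) _  = -‿inverseʳ 0#

  ----------------------------------------------------------------------
  -- The 𝐚𝐛-index and the 𝐚𝐛-series

  module _ {m : ℕ} (Q : FiniteGradedPoset m) where
    open FiniteGradedPoset Q

    -- The weight of p < x₁ < ⋯ < xₖ < q, given the list x₁ , … , xₖ.
    weight : Carrier → List Carrier → Carrier → Series
    weight p []      q = (a ⊖ b) ** (ρ[ p , q ] ∸ 1)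
    weight p (r ∷ c) q = (a ⊖ b) ** (ρ[ p , r ] ∸ 1) ⊙ b ⊙ weight r c q

    Ψ : Series
    Ψ w = sumᴷ (map (λ c → weight 0̂ c 1̂ w) chains)

    weight-homogeneous : ∀ p c q → p ∈ elements → All (_∈ elements) c →
      q ∈ elements → Linked _<_ (p ∷ c ++ [ q ]) →
      ∃[ d ] ρ q ≡ ρ p ℤ.+ +[1+ d ] × Homogeneous d (weight p c q)
    weight-homogeneous p [] q p∈ [] q∈ (p<q ∷ [-])
      with d , eq ← <⇒+ (ρ-mono p∈ q∈ p<q) =
      d , eq , subst (λ k → Homogeneous k ((a ⊖ b) ** (ρ[ p , q ] ∸ 1)))
                 (trans (cong (λ z → ∣ z ℤ.- ρ p ∣ ∸ 1) eq)
                        (cong (_∸ 1) (∣i+k-i∣ (ρ p) (suc d))))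
                 (**-homogeneous a⊖b-homogeneous _)
    weight-homogeneous p (r ∷ c) q p∈ (r∈ ∷ c∈) q∈ (p<r ∷ chain)
      with d , eq , hd ← weight-homogeneous p [] r p∈ [] r∈ (p<r ∷ [-])
      with e , eq′ , he ← weight-homogeneous r c q r∈ c∈ q∈ chain =
      d ℕ.+ 1 ℕ.+ e
      , trans eq′ (trans (cong (ℤ._+ +[1+ e ]) eq)
          (trans (ℤ.+-assoc (ρ p) +[1+ d ] +[1+ e ])
            (cong (λ k → ρ p ℤ.+ +[1+ k ]) (sym (ℕ.+-assoc d 1 e)))))
      , ⊙-homogeneous (⊙-homogeneous hd b-homogeneous) he

    tuples-∈ : ∀ k → All (All (_∈ elements)) (tuples k)
    tuples-∈ zero    = [] ∷ []
    tuples-∈ (suc k) = All.tabulate λ c∈ →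
      help (∈-cartesianProductWith⁻ _∷_ elements (tuples k) c∈)
      where
      help : ∀ {c} → ∃[ p ] ∃[ t ] p ∈ elements × t ∈ tuples k × c ≡ p ∷ t →
             All (_∈ elements) c
      help (p , t , p∈ , t∈ , refl) = p∈ ∷ All.lookup (tuples-∈ k) t∈

    Ψ-homogeneous : Homogeneous m Ψ
    Ψ-homogeneous w ≢m = sumᴷ-zero _ chains
      (All.tabulate λ {c} c∈ →
        let c∈tuples , chain = ∈-filter⁻ isChain? {xs = concatMap tuples (upTo (suc m))} c∈
            members = All.lookup (All.concat⁺ {xss = map tuples (upTo (suc m))}
                        (All.map⁺ {xs = upTo (suc m)} (All.tabulate λ {k} _ → tuples-∈ k))) c∈tuples
            d , eq , hd = weight-homogeneous 0̂ c 1̂ 0̂∈ members 1̂∈ chain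
            m≡d = ℕ.suc-injective (ℤ.+-injective
                    (trans (sym ρ-1̂) (trans eq (trans (cong (ℤ._+ +[1+ d ]) ρ-0̂) (ℤ.+-identityˡ _)))))
        in hd w λ w≡d → ≢m (trans w≡d (sym m≡d)))

  module _ {n : ℕ} (M : Matrix n) (x y : Fin n) where
    open LevelPoset M

    -- (x , 0) and (y , m+1) are distinct, so they are comparable if and
    -- only if they are strictly comparable.
    Ψ[_] : ℕ → Series
    Ψ[ m ] with bottom x y m <? top x y m
    ... | yes b<t = Ψ (interval x y m b<t)
    ... | no  _   = 𝟘

    -- The infinite sum of the Ψ[ m ], m ≥ 0: as Ψ[ m ] is homogeneous of
    -- degree m, its coefficient at w vanishes for m > length w.
    abSeries : Series
    abSeries w = sumᴷ (map (λ m → Ψ[ m ] w) (upTo (suc (length w))))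

{-# OPTIONS --safe #-}

-- Group the chains from (x , 0) to level m + 1 by their first jump.  Let Bₖ be
-- the 0/1 support of M^(k+1), and let Φ k x be the sum over chains from x to y
-- whose first jump exceeds k levels, with the first k factors 𝐚−𝐛 of the weight
-- removed.  Splitting off one letter gives the linear system
--   Φ k x = Bₖ(x,y) + Σ_z Bₖ(x,z) 𝐛 Φ 0 z + (𝐚−𝐛) Φ (k+1) x,   Φ 0 x = Ψ_{x,y}.
-- There are finitely many supports, so Bₖ is eventually periodic in k and the
-- system is finite.  The coefficients of its unknowns are rational without
-- constant term, so it is solved by Gaussian elimination using the inverses of
-- series 1 − p.

module Submission where

open import Defs
open import Algebra.Apartness.Bundles using (HeytingField; module HeytingCommutativeRing)
open import Algebra.Bundles using (CommutativeRing; Ring)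
open import Data.Bool.Base using (Bool; true; false; _∧_)
open import Data.Empty using (⊥-elim)
open import Data.Fin.Base using (Fin; toℕ; funToFin; finToFun)
  renaming (zero to fzero; suc to fsuc)
import Data.Fin.Properties as Fin
open import Data.Integer.Base as ℤ using (+_; ∣_∣)
import Data.Integer.Properties as ℤ
open import Data.List.Base
  using (List; []; _∷_; [_]; _++_; map; filter; length; upTo; applyUpTo; allFin;
         concatMap; cartesianProductWith)
open import Data.List.Properties using (map-∘; map-applyUpTo; map-upTo)
open import Data.List.Relation.Unary.Any using (here; there)
open import Data.List.Relation.Unary.Linked using (linked?)
open import Data.Nat.Base as ℕ using (ℕ; zero; suc; z≤n; s≤s; z<s; _∸_)
import Data.Nat.Properties as ℕ
open import Data.Product.Base using (∃-syntax; _×_; _,_; proj₂)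
open import Data.Sum.Base using (inj₁; inj₂)
open import Function.Base using (_∘_)
open import Function.Bundles using (mk⇔)
open import Level using (_⊔_)
open import Relation.Binary.PropositionalEquality as ≡ using (_≡_)
open import Relation.Nullary using (¬_; Dec; yes; no; does)
open import Relation.Nullary.Decidable using (does-⇔; dec-false)
open import Relation.Unary using (Pred) renaming (Decidable to Decidable₁)

-- The ring of series

module SeriesRing {c ℓ₁ ℓ₂} (K : HeytingField c ℓ₁ ℓ₂) where
  open PowerSeries K public

  commutativeRing : CommutativeRing c ℓ₁
  commutativeRing =
    HeytingCommutativeRing.commutativeRing (HeytingField.heytingCommutativeRing K)

  open CommutativeRing commutativeRing public
    renaming (Carrier to 𝕂)
  open HeytingField K public using (_#_; invertible⇒#)
  open import Relation.Binary.Reasoning.Setoid setoid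
  open import Algebra.Properties.Ring ring public
    using (-0#≈0#; -1*x≈-x)
  open import Algebra.Properties.CommutativeSemigroup +-commutativeSemigroup public
    using (interchange)
  open import Algebra.Properties.CommutativeSemigroup *-commutativeSemigroup public
    using (x∙yz≈y∙xz)
  open import Algebra.Solver.Ring.NaturalCoefficients.Default commutativeSemiring
    using (solve; con; _:+_; _:*_; _:=_)

  -- The left (Brzozowski) derivative by a letter; `⊙-∷` is its product rule and drives the
  -- inductions on words below.
  ∂ : Letter → Series → Series
  ∂ l f w = f (l ∷ w)

  infixr 7 _·_
  _·_ : 𝕂 → Series → Series
  (k · f) w = k * f w

  ⊝_ : Series → Series
  (⊝ f) w = - f w

  ≈0-* : ∀ {x} → x ≈ 0# → ∀ y → x * y ≈ 0#
  ≈0-* x≈0 y = trans (*-congʳ x≈0) (zeroˡ y)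

  *-≈0 : ∀ x {y} → y ≈ 0# → x * y ≈ 0#
  *-≈0 x y≈0 = trans (*-congˡ y≈0) (zeroʳ x)

  ⊙-[] : ∀ f g → (f ⊙ g) [] ≈ f [] * g []
  ⊙-[] f g = +-identityʳ _

  ⊙-local : ∀ f {g h} w → (∀ v → length v ℕ.≤ length w → g v ≈ h v) →
            (f ⊙ g) w ≈ (f ⊙ h) w
  ⊙-local f         []      p = +-congʳ (*-congˡ (p [] z≤n))
  ⊙-local f {g} {h} (l ∷ w) p
    rewrite ⊙-∷ f g l w | ⊙-∷ f h l w =
    +-cong (*-congˡ (p (l ∷ w) ℕ.≤-refl))
           (⊙-local (∂ l f) w λ v v≤w → p v (ℕ.m≤n⇒m≤1+n v≤w))

  -- Left multiplication by a series without constant term only sees strictly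
  -- shorter words; this is why x = r + p x has exactly one solution.
  ⊙-contracts : ∀ {f g h} → f [] ≈ 0# → ∀ w →
                (∀ v → length v ℕ.< length w → g v ≈ h v) → (f ⊙ g) w ≈ (f ⊙ h) w
  ⊙-contracts {f} {g} {h} f≈0 [] p =
    +-congʳ (trans (≈0-* f≈0 _) (sym (≈0-* f≈0 _)))
  ⊙-contracts {f} {g} {h} f≈0 (l ∷ w) p
    rewrite ⊙-∷ f g l w | ⊙-∷ f h l w =
    +-cong (trans (≈0-* f≈0 _) (sym (≈0-* f≈0 _)))
           (⊙-local (∂ l f) w λ v v≤w → p v (s≤s v≤w))

  ⊙-cong : ∀ {f f′ g g′} → f ≋ f′ → g ≋ g′ → f ⊙ g ≋ f′ ⊙ g′
  ⊙-cong p q [] = +-congʳ (*-cong (p []) (q []))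
  ⊙-cong {f} {f′} {g} {g′} p q (l ∷ w)
    rewrite ⊙-∷ f g l w | ⊙-∷ f′ g′ l w =
    +-cong (*-cong (p []) (q (l ∷ w))) (⊙-cong (p ∘ (l ∷_)) q w)

  ⊙-distribˡ-⊕ : ∀ f g h → f ⊙ (g ⊕ h) ≋ f ⊙ g ⊕ f ⊙ h
  ⊙-distribˡ-⊕ f g h [] =
    solve 3 (λ x y z → x :* (y :+ z) :+ con 0 := (x :* y :+ con 0) :+ (x :* z :+ con 0))
      refl (f []) (g []) (h [])
  ⊙-distribˡ-⊕ f g h (l ∷ w)
    rewrite ⊙-∷ f (g ⊕ h) l w | ⊙-∷ f g l w | ⊙-∷ f h l w =
    trans (+-congˡ (⊙-distribˡ-⊕ (∂ l f) g h w))
      (solve 5 (λ x y z u v → x :* (y :+ z) :+ (u :+ v) := (x :* y :+ u) :+ (x :* z :+ v))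
        refl (f []) (g (l ∷ w)) (h (l ∷ w)) _ _)

  ⊙-distribʳ-⊕ : ∀ f g h → (g ⊕ h) ⊙ f ≋ g ⊙ f ⊕ h ⊙ f
  ⊙-distribʳ-⊕ f g h [] =
    solve 3 (λ x y z → (y :+ z) :* x :+ con 0 := (y :* x :+ con 0) :+ (z :* x :+ con 0))
      refl (f []) (g []) (h [])
  ⊙-distribʳ-⊕ f g h (l ∷ w)
    rewrite ⊙-∷ (g ⊕ h) f l w | ⊙-∷ g f l w | ⊙-∷ h f l w =
    trans (+-congˡ (⊙-distribʳ-⊕ f (∂ l g) (∂ l h) w))
      (solve 5 (λ x y z u v → (y :+ z) :* x :+ (u :+ v) := (y :* x :+ u) :+ (z :* x :+ v))
        refl (f (l ∷ w)) (g []) (h []) _ _)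

  ·-⊙ : ∀ k f g → (k · f) ⊙ g ≋ k · (f ⊙ g)
  ·-⊙ k f g [] =
    solve 3 (λ x y z → (x :* y) :* z :+ con 0 := x :* (y :* z :+ con 0)) refl k (f []) (g [])
  ·-⊙ k f g (l ∷ w) rewrite ⊙-∷ (k · f) g l w | ⊙-∷ f g l w =
    trans (+-congˡ (·-⊙ k (∂ l f) g w))
      (solve 4 (λ x y z u → (x :* y) :* z :+ x :* u := x :* (y :* z :+ u))
        refl k (f []) (g (l ∷ w)) _)

  -- Induction on the word by the product rule: the derivative of `f ⊙ g` is
  -- `f [] · ∂ l g ⊕ ∂ l f ⊙ g`, so sums and scalars are first pulled out of the left factor.
  ⊙-assoc : ∀ f g h → (f ⊙ g) ⊙ h ≋ f ⊙ (g ⊙ h)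
  ⊙-assoc f g h [] =
    solve 3 (λ x y z → (x :* y :+ con 0) :* z :+ con 0 := x :* (y :* z :+ con 0) :+ con 0)
      refl (f []) (g []) (h [])
  ⊙-assoc f g h (l ∷ w) = begin
    ((f ⊙ g) ⊙ h) (l ∷ w)
      ≡⟨ ⊙-∷ (f ⊙ g) h l w ⟩
    (f ⊙ g) [] * h (l ∷ w) + (∂ l (f ⊙ g) ⊙ h) w
      ≈⟨ +-cong (*-congʳ (⊙-[] f g)) (⊙-cong (λ v → reflexive (⊙-∷ f g l v)) (λ _ → refl) w) ⟩
    f [] * g [] * h (l ∷ w) + ((f [] · ∂ l g ⊕ ∂ l f ⊙ g) ⊙ h) w
      ≈⟨ +-congˡ (⊙-distribʳ-⊕ h (f [] · ∂ l g) (∂ l f ⊙ g) w) ⟩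
    f [] * g [] * h (l ∷ w) + (((f [] · ∂ l g) ⊙ h) w + ((∂ l f ⊙ g) ⊙ h) w)
      ≈⟨ +-congˡ (+-cong (·-⊙ (f []) (∂ l g) h w) (⊙-assoc (∂ l f) g h w)) ⟩
    f [] * g [] * h (l ∷ w) + (f [] * (∂ l g ⊙ h) w + (∂ l f ⊙ (g ⊙ h)) w)
      ≈⟨ solve 5 (λ x y z u v → x :* y :* z :+ (x :* u :+ v) := x :* (y :* z :+ u) :+ v)
           refl (f []) (g []) (h (l ∷ w)) _ _ ⟩
    f [] * (g [] * h (l ∷ w) + (∂ l g ⊙ h) w) + (∂ l f ⊙ (g ⊙ h)) w
      ≡⟨ ≡.cong (λ x → f [] * x + (∂ l f ⊙ (g ⊙ h)) w) (⊙-∷ g h l w) ⟨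
    f [] * (g ⊙ h) (l ∷ w) + (∂ l f ⊙ (g ⊙ h)) w
      ≡⟨ ⊙-∷ f (g ⊙ h) l w ⟨
    (f ⊙ (g ⊙ h)) (l ∷ w) ∎

  𝟘-⊙ : ∀ f → 𝟘 ⊙ f ≋ 𝟘
  𝟘-⊙ f w = ⊙-zero 𝟘 f w λ _ _ _ → zeroˡ _

  ⊙-𝟘 : ∀ f → f ⊙ 𝟘 ≋ 𝟘
  ⊙-𝟘 f w = ⊙-zero f 𝟘 w λ _ _ _ → zeroʳ _

  𝟙-⊙ : ∀ f → 𝟙 ⊙ f ≋ f
  𝟙-⊙ f []      = trans (+-identityʳ _) (*-identityˡ _)
  𝟙-⊙ f (l ∷ w) rewrite ⊙-∷ 𝟙 f l w =
    trans (+-cong (*-identityˡ _) (𝟘-⊙ f w)) (+-identityʳ _)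

  ⊙-𝟙 : ∀ f → f ⊙ 𝟙 ≋ f
  ⊙-𝟙 f []      = trans (+-identityʳ _) (*-identityʳ _)
  ⊙-𝟙 f (l ∷ w) rewrite ⊙-∷ f 𝟙 l w =
    trans (+-cong (zeroʳ _) (⊙-𝟙 (∂ l f) w)) (+-identityˡ _)

  seriesRing : Ring c ℓ₁
  seriesRing = record
    { Carrier = Series
    ; _≈_     = _≋_
    ; _+_     = _⊕_
    ; _*_     = _⊙_
    ; -_      = ⊝_
    ; 0#      = 𝟘
    ; 1#      = 𝟙
    ; isRing  = record
      { +-isAbelianGroup = record
        { isGroup = record
          { isMonoid = record
            { isSemigroup = record
              { isMagma = record
                { isEquivalence = record
                  { refl  = λ _ → refl
                  ; sym   = λ p w → sym (p w)
                  ; trans = λ p q w → trans (p w) (q w)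
                  }
                ; ∙-cong = λ p q w → +-cong (p w) (q w)
                }
              ; assoc = λ f g h w → +-assoc _ _ _
              }
            ; identity = (λ f w → +-identityˡ _) , (λ f w → +-identityʳ _)
            }
          ; inverse = (λ f w → -‿inverseˡ _) , (λ f w → -‿inverseʳ _)
          ; ⁻¹-cong = λ p w → -‿cong (p w)
          }
        ; comm = λ f g w → +-comm _ _
        }
      ; *-cong     = ⊙-cong
      ; *-assoc    = ⊙-assoc
      ; *-identity = 𝟙-⊙ , ⊙-𝟙
      ; distrib    = ⊙-distribˡ-⊕ , ⊙-distribʳ-⊕
      }
    }

-- Rational series and linear systems

module Rationality {c ℓ₁ ℓ₂} (K : HeytingField c ℓ₁ ℓ₂) where
  open SeriesRing K
  private module S where
    open Ring seriesRing public
    open import Algebra.Properties.Ring seriesRing public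
  open import Relation.Binary.Reasoning.Setoid S.setoid

  Proper : Series → Set ℓ₁
  Proper f = f [] ≈ 0#

  ⊙-proper : ∀ f g → Proper g → Proper (f ⊙ g)
  ⊙-proper f g p = trans (⊙-[] f g) (*-≈0 (f []) p)

  proper-⊙ : ∀ f g → Proper f → Proper (f ⊙ g)
  proper-⊙ f g p = trans (⊙-[] f g) (≈0-* p (g []))

  ⊙-fixpoint-unique : ∀ {p r f g} → Proper p →
                      f ≋ r ⊕ p ⊙ f → g ≋ r ⊕ p ⊙ g → f ≋ g
  ⊙-fixpoint-unique {p} {r} {f} {g} p≈0 f≋ g≋ w = go w (ℕ.n<1+n _)
    where
    -- The recursion runs on a bound for the length, since `⊙-contracts` asks for agreement on all
    -- shorter words, not only on tails.
    go : ∀ {k} w → length w ℕ.< k → f w ≈ g w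
    go {suc k} w (s≤s w≤k) = trans (f≋ w) (trans
      (+-congˡ (⊙-contracts p≈0 w λ v v<w → go v (ℕ.<-≤-trans v<w w≤k)))
      (sym (g≋ w)))

  -- Geometric series of a proper series

  module Star {p : Series} (p≈0 : Proper p) where
    -- The truncations 1 + p + ... + p^(k-1). As `p` is proper, the coefficient at `w` no longer
    -- changes once k exceeds the length of `w`; `star` reads it off at the first such k.
    partialSum : ℕ → Series
    partialSum zero    = 𝟘
    partialSum (suc k) = 𝟙 ⊕ p ⊙ partialSum k

    partialSum-stable : ∀ {k l} w → length w ℕ.< k → length w ℕ.< l →
                        partialSum k w ≈ partialSum l w
    partialSum-stable {suc k} {suc l} w (s≤s w≤k) (s≤s w≤l) =
      +-congˡ (⊙-contracts p≈0 w λ v v<w →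
        partialSum-stable v (ℕ.<-≤-trans v<w w≤k) (ℕ.<-≤-trans v<w w≤l))

    star : Series
    star w = partialSum (suc (length w)) w

    star-unfold : star ≋ 𝟙 ⊕ p ⊙ star
    star-unfold w = +-congˡ (⊙-contracts p≈0 w λ v v<w →
      partialSum-stable v v<w (ℕ.n<1+n _))

    ⊙-unfold : ∀ g → star ⊙ g ≋ g ⊕ p ⊙ (star ⊙ g)
    ⊙-unfold g = begin
      star ⊙ g                ≈⟨ S.*-congʳ star-unfold ⟩
      (𝟙 ⊕ p ⊙ star) ⊙ g      ≈⟨ S.distribʳ g 𝟙 (p ⊙ star) ⟩
      𝟙 ⊙ g ⊕ p ⊙ star ⊙ g    ≈⟨ S.+-cong (S.*-identityˡ g) (S.*-assoc p star g) ⟩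
      g ⊕ p ⊙ (star ⊙ g)      ∎

    inverseʳ : (𝟙 ⊖ p) ⊙ star ≋ 𝟙
    inverseʳ = begin
      (𝟙 ⊖ p) ⊙ star             ≈⟨ S.[y-z]x≈yx-zx star 𝟙 p ⟩
      𝟙 ⊙ star ⊖ p ⊙ star        ≈⟨ S.+-congʳ (S.*-identityˡ star) ⟩
      star ⊖ p ⊙ star            ≈⟨ S.+-congʳ star-unfold ⟩
      (𝟙 ⊕ p ⊙ star) ⊖ p ⊙ star  ≈⟨ S.+-assoc 𝟙 (p ⊙ star) (⊝ (p ⊙ star)) ⟩
      𝟙 ⊕ (p ⊙ star ⊖ p ⊙ star)  ≈⟨ S.+-congˡ {𝟙} (S.-‿inverseʳ (p ⊙ star)) ⟩
      𝟙 ⊕ 𝟘                      ≈⟨ S.+-identityʳ 𝟙 ⟩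
      𝟙                          ∎

    -- Both sides solve x = (1 - p) + p x, which has only one solution.
    inverseˡ : star ⊙ (𝟙 ⊖ p) ≋ 𝟙
    inverseˡ = ⊙-fixpoint-unique p≈0 (⊙-unfold (𝟙 ⊖ p)) (begin
      𝟙                  ≈⟨ S.+-identityʳ 𝟙 ⟨
      𝟙 ⊕ 𝟘              ≈⟨ S.+-congˡ {𝟙} (S.-‿inverseˡ p) ⟨
      𝟙 ⊕ (⊝ p ⊕ p)      ≈⟨ S.+-assoc 𝟙 (⊝ p) p ⟨
      (𝟙 ⊖ p) ⊕ p        ≈⟨ S.+-congˡ {𝟙 ⊖ p} (S.*-identityʳ p) ⟨
      (𝟙 ⊖ p) ⊕ p ⊙ 𝟙    ∎)

  open Star public using (star; ⊙-unfold)

  constant : 𝕂 → Series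
  constant k = k · 𝟙

  constant-⊙ : ∀ k f → constant k ⊙ f ≋ k · f
  constant-⊙ k f w = trans (·-⊙ k 𝟙 f w) (*-congˡ (𝟙-⊙ f w))

  constant-rational : ∀ k → IsRational (constant k)
  constant-rational k = polynomial ([ [] ] , λ
    { []      []∉ → ⊥-elim ([]∉ (here ≡.refl))
    ; (_ ∷ _) _   → zeroʳ k
    })

  -- Negation is multiplication by the constant polynomial -1.
  ⊝-rational : ∀ {f} → IsRational f → IsRational (⊝ f)
  ⊝-rational {f} rf = respects
    (λ w → trans (constant-⊙ (- 1#) f w) (-1*x≈-x (f w)))
    (times (constant-rational (- 1#)) rf)

  star-rational : ∀ {p} (p≈0 : Proper p) → IsRational p → IsRational (star p≈0)
  star-rational {p} p≈0 rp = inverse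
    (plus (respects (λ w → *-identityˡ (𝟙 w)) (constant-rational 1#)) (⊝-rational rp))
    -- Apartness from 0 is obtained from invertibility of the difference with 0; the constant term
    -- of `𝟙 ⊖ p` is 1, whose inverse is 1.
    (invertible⇒# (1# , trans (*-identityˡ _) 1-p≈1 , trans (*-identityʳ _) 1-p≈1))
    (Star.inverseʳ p≈0 , Star.inverseˡ p≈0)
    where
    1-p≈1 : 1# + - p [] + - 0# ≈ 1#
    1-p≈1 = trans (+-cong (trans (+-congˡ (trans (-‿cong p≈0) -0#≈0#)) (+-identityʳ _)) -0#≈0#)
                  (+-identityʳ _)

  -- Affine expressions in unknowns `F i`, with rational coefficients on the left. Coefficients of
  -- unknowns must be proper, so that an equation for an unknown can be solved by a `star`; `scale`
  -- accepts any rational factor, as left multiplication preserves properness.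
  data Affine {n} (F : Fin n → Series) : Series → Set (c ⊔ ℓ₁ ⊔ ℓ₂) where
    const           : ∀ {f} → IsRational f → Affine F f
    term            : ∀ {p} → IsRational p → Proper p → ∀ i → Affine F (p ⊙ F i)
    sum             : ∀ {f g} → Affine F f → Affine F g → Affine F (f ⊕ g)
    scale           : ∀ {p f} → IsRational p → Affine F f → Affine F (p ⊙ f)
    affine-respects : ∀ {f g} → f ≋ g → Affine F f → Affine F g

  𝟘-rational : IsRational 𝟘
  𝟘-rational = polynomial ([] , λ _ _ → refl)

  -- Arden's rule: `star ⊙ g` solves the same equation as `f`, and for proper `p` the solution is
  -- unique.
  affine-fixpoint : ∀ {n} {F : Fin n → Series} {p f g} → IsRational p → Proper p →
                    Affine F g → f ≋ g ⊕ p ⊙ f → Affine F f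
  affine-fixpoint {g = g} rp p≈0 ag f≋ = affine-respects
    (⊙-fixpoint-unique p≈0 (⊙-unfold p≈0 g) f≋) (scale (star-rational p≈0 rp) ag)

  -- Preparation for eliminating the first unknown: its coefficients are gathered into a single `p`,
  -- which stays rational and proper under sums and left multiples.
  isolate : ∀ {n} {F : Fin (suc n) → Series} {f} → Affine F f →
            ∃[ p ] ∃[ g ] IsRational p × Proper p × Affine (F ∘ fsuc) g ×
              f ≋ g ⊕ p ⊙ F fzero
  isolate {F = F} (const {f} rf) =
    𝟘 , f , 𝟘-rational , refl , const rf ,
    S.sym (S.trans (S.+-congˡ {f} (S.zeroˡ (F fzero))) (S.+-identityʳ f))
  isolate {F = F} (term {p} rp p≈0 fzero) =
    p , 𝟘 , rp , p≈0 , const 𝟘-rational , S.sym (S.+-identityˡ (p ⊙ F fzero))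
  isolate {F = F} (term {p} rp p≈0 (fsuc i)) =
    𝟘 , p ⊙ F (fsuc i) , 𝟘-rational , refl , term rp p≈0 i ,
    S.sym (S.trans (S.+-congˡ {p ⊙ F (fsuc i)} (S.zeroˡ (F fzero)))
                   (S.+-identityʳ (p ⊙ F (fsuc i))))
  isolate {F = F} (sum {f} {f′} af af′)
    with p , g , rp , p≈0 , ag , f≋ ← isolate af
       | p′ , g′ , rp′ , p′≈0 , ag′ , f′≋ ← isolate af′ =
    p ⊕ p′ , g ⊕ g′ , plus rp rp′ , 0+0 p≈0 p′≈0 , sum ag ag′ , (begin
      f ⊕ f′                                        ≈⟨ S.+-cong f≋ f′≋ ⟩
      (g ⊕ p ⊙ F fzero) ⊕ (g′ ⊕ p′ ⊙ F fzero)
        ≈⟨ (λ w → interchange (g w) _ (g′ w) _) ⟩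
      (g ⊕ g′) ⊕ (p ⊙ F fzero ⊕ p′ ⊙ F fzero)
        ≈⟨ S.+-congˡ {g ⊕ g′} (S.distribʳ (F fzero) p p′) ⟨
      (g ⊕ g′) ⊕ (p ⊕ p′) ⊙ F fzero                 ∎)
  isolate {F = F} (scale {q} {f} rq af)
    with p , g , rp , p≈0 , ag , f≋ ← isolate af =
    q ⊙ p , q ⊙ g , times rq rp , ⊙-proper q p p≈0 , scale rq ag , (begin
      q ⊙ f                          ≈⟨ S.*-congˡ {q} f≋ ⟩
      q ⊙ (g ⊕ p ⊙ F fzero)          ≈⟨ S.distribˡ q g (p ⊙ F fzero) ⟩
      q ⊙ g ⊕ q ⊙ (p ⊙ F fzero)      ≈⟨ S.+-congˡ {q ⊙ g} (S.*-assoc q p (F fzero)) ⟨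
      q ⊙ g ⊕ (q ⊙ p) ⊙ F fzero      ∎)
  isolate (affine-respects f≋f′ af)
    with p , g , rp , p≈0 , ag , f≋ ← isolate af =
    p , g , rp , p≈0 , ag , S.trans (S.sym f≋f′) f≋

  -- Induction on the number of unknowns. With none left, an expression is built from rational
  -- constants alone; otherwise the first unknown is solved for and substituted everywhere.
  affine⇒rational : ∀ {n} {F : Fin n → Series} → (∀ i → Affine F (F i)) →
                    ∀ {f} → Affine F f → IsRational f
  affine⇒rational {zero} aF (const rf)     = rf
  affine⇒rational {zero} aF (sum af ag)    = plus (affine⇒rational aF af) (affine⇒rational aF ag)
  affine⇒rational {zero} aF (scale rp af)  = times rp (affine⇒rational aF af)
  affine⇒rational {zero} aF (affine-respects f≋g af) = respects f≋g (affine⇒rational aF af)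
  affine⇒rational {suc n} {F} aF af =
    affine⇒rational (eliminate ∘ aF ∘ fsuc) (eliminate af)
    where
    -- The first equation reads F₀ = g + p F₀ with `g` in the later unknowns only, so Arden's rule
    -- expresses F₀ by those.
    a₀ : Affine (F ∘ fsuc) (F fzero)
    a₀ with p , g , rp , p≈0 , ag , F₀≋ ← isolate (aF fzero) =
      affine-fixpoint rp p≈0 ag F₀≋
    eliminate : ∀ {f} → Affine F f → Affine (F ∘ fsuc) f
    eliminate af with p , g , rp , p≈0 , ag , f≋ ← isolate af =
      affine-respects (S.sym f≋) (sum ag (scale rp a₀))

-- Finite sums and chains

module Sums {c ℓ₁ ℓ₂} (K : HeytingField c ℓ₁ ℓ₂) where
  open SeriesRing K
  open import Relation.Binary.Reasoning.Setoid setoid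
  private variable
    A C : Set

  ∑ : List A → (A → 𝕂) → 𝕂
  ∑ xs f = sumᴷ (map f xs)

  ∑-cong : ∀ (xs : List A) {f g} → (∀ x → f x ≈ g x) → ∑ xs f ≈ ∑ xs g
  ∑-cong []       p = refl
  ∑-cong (x ∷ xs) p = +-cong (p x) (∑-cong xs p)

  ∑-0 : ∀ (xs : List A) {f} → (∀ x → f x ≈ 0#) → ∑ xs f ≈ 0#
  ∑-0 []       p = refl
  ∑-0 (x ∷ xs) p = 0+0 (p x) (∑-0 xs p)

  ∑-+ : ∀ (xs : List A) f g → ∑ xs (λ x → f x + g x) ≈ ∑ xs f + ∑ xs g
  ∑-+ []       f g = sym (+-identityˡ 0#)
  ∑-+ (x ∷ xs) f g = trans (+-congˡ (∑-+ xs f g)) (interchange _ _ _ _)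

  ∑-* : ∀ (xs : List A) k f → ∑ xs (λ x → k * f x) ≈ k * ∑ xs f
  ∑-* []       k f = sym (zeroʳ k)
  ∑-* (x ∷ xs) k f = trans (+-congˡ (∑-* xs k f)) (sym (distribˡ k _ _))

  ∑-swap : ∀ (xs : List A) (ys : List C) (f : A → C → 𝕂) →
           ∑ xs (λ x → ∑ ys (f x)) ≈ ∑ ys (λ y → ∑ xs (λ x → f x y))
  ∑-swap []       ys f = sym (∑-0 ys λ _ → refl)
  ∑-swap (x ∷ xs) ys f = trans (+-congˡ (∑-swap xs ys f)) (sym (∑-+ ys _ _))

  ∑-++ : ∀ (xs ys : List A) f → ∑ (xs ++ ys) f ≈ ∑ xs f + ∑ ys f
  ∑-++ []       ys f = sym (+-identityˡ _)
  ∑-++ (x ∷ xs) ys f = trans (+-congˡ (∑-++ xs ys f)) (sym (+-assoc _ _ _))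

  ∑-map : ∀ (g : A → C) xs (f : C → 𝕂) → ∑ (map g xs) f ≡ ∑ xs (f ∘ g)
  ∑-map g xs f = ≡.cong sumᴷ (≡.sym (map-∘ xs))

  ∑-concatMap : ∀ (g : A → List C) xs f → ∑ (concatMap g xs) f ≈ ∑ xs (λ x → ∑ (g x) f)
  ∑-concatMap g []       f = refl
  ∑-concatMap g (x ∷ xs) f =
    trans (∑-++ (g x) (concatMap g xs) f) (+-congˡ (∑-concatMap g xs f))

  ∑-cartesianProductWith : ∀ {D : Set} (_∙_ : A → C → D) xs ys f →
    ∑ (cartesianProductWith _∙_ xs ys) f ≈ ∑ xs (λ x → ∑ ys (λ y → f (x ∙ y)))
  ∑-cartesianProductWith _∙_ []       ys f = refl
  ∑-cartesianProductWith _∙_ (x ∷ xs) ys f =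
    trans (∑-++ (map (x ∙_) ys) (cartesianProductWith _∙_ xs ys) f)
      (+-cong (reflexive (∑-map (x ∙_) ys f)) (∑-cartesianProductWith _∙_ xs ys f))

  ∑-applyUpTo-suc : ∀ n (f : ℕ → 𝕂) → ∑ (applyUpTo suc n) f ≡ ∑ (upTo n) (f ∘ suc)
  ∑-applyUpTo-suc n f = ≡.cong sumᴷ
    (≡.trans (map-applyUpTo suc f n) (≡.sym (map-upTo (f ∘ suc) n)))

  ∑-upTo-suc : ∀ n (f : ℕ → 𝕂) → ∑ (upTo (suc n)) f ≡ f 0 + ∑ (upTo n) (f ∘ suc)
  ∑-upTo-suc n f = ≡.cong (λ s → f 0 + s) (∑-applyUpTo-suc n f)

  ∑-drop : ∀ i n (f : ℕ → 𝕂) → (∀ j → j ℕ.< i → f j ≈ 0#) →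
           ∑ (upTo (i ℕ.+ n)) f ≈ ∑ (upTo n) (λ j → f (i ℕ.+ j))
  ∑-drop zero    n f p = refl
  ∑-drop (suc i) n f p = begin
    ∑ (upTo (suc i ℕ.+ n)) f               ≡⟨ ∑-upTo-suc (i ℕ.+ n) f ⟩
    f 0 + ∑ (upTo (i ℕ.+ n)) (f ∘ suc)
      ≈⟨ +-cong (p 0 z<s) (∑-drop i n (f ∘ suc) λ j j<i → p (suc j) (s≤s j<i)) ⟩
    0# + ∑ (upTo n) (λ j → f (suc i ℕ.+ j)) ≈⟨ +-identityˡ _ ⟩
    ∑ (upTo n) (λ j → f (suc i ℕ.+ j))     ∎

  -- The Iverson bracket: a filtered sum becomes a full sum with 0/1 coefficients, whose order of
  -- summation can be exchanged.
  ⟦_⟧ : Bool → 𝕂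
  ⟦ true  ⟧ = 1#
  ⟦ false ⟧ = 0#

  ⟦⟧-∧ : ∀ s t → ⟦ s ∧ t ⟧ ≈ ⟦ s ⟧ * ⟦ t ⟧
  ⟦⟧-∧ true  t = sym (*-identityˡ _)
  ⟦⟧-∧ false t = sym (zeroˡ _)

  ∑-filter : ∀ {p} {P : Pred A p} (P? : Decidable₁ P) xs f →
             ∑ (filter P? xs) f ≈ ∑ xs (λ x → ⟦ does (P? x) ⟧ * f x)
  ∑-filter P? []       f = refl
  ∑-filter P? (x ∷ xs) f with does (P? x)
  ... | true  = +-cong (sym (*-identityˡ _)) (∑-filter P? xs f)
  ... | false = trans (∑-filter P? xs f)
                  (sym (trans (+-congʳ (zeroˡ _)) (+-identityˡ _)))

  ⊙-∑ : ∀ f (xs : List A) (g : A → Series) →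
        f ⊙ (λ w → ∑ xs (λ x → g x w)) ≋ λ w → ∑ xs (λ x → (f ⊙ g x) w)
  ⊙-∑ f []       g = ⊙-𝟘 f
  ⊙-∑ f (x ∷ xs) g w = trans (⊙-distribˡ-⊕ f (g x) _ w) (+-congˡ (⊙-∑ f xs g w))

  ⊙-· : ∀ k f g → f ⊙ (k · g) ≋ k · (f ⊙ g)
  ⊙-· k f g [] = trans (⊙-[] f (k · g)) (trans (x∙yz≈y∙xz _ _ _) (*-congˡ (sym (⊙-[] f g))))
  ⊙-· k f g (l ∷ w) rewrite ⊙-∷ f (k · g) l w | ⊙-∷ f g l w =
    trans (+-cong (x∙yz≈y∙xz _ _ _) (⊙-· k (∂ l f) g w)) (sym (distribˡ k _ _))

  -- Recursion on the first interior element of a chain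

  module _ {m : ℕ} (Q : FiniteGradedPoset m) where
    open FiniteGradedPoset Q

    -- Chains from `p` to `1̂` with fewer than `N` interior elements. The starting point is free so
    -- that the first interior element can be removed.
    chainsFrom : Carrier → ℕ → Series
    chainsFrom p N w = ∑ (concatMap tuples (upTo N))
      (λ c → ⟦ does (linked? _<?_ (p ∷ c ++ [ 1̂ ])) ⟧ * weight Q p c 1̂ w)

    Ψ≋chainsFrom : Ψ Q ≋ chainsFrom 0̂ (suc m)
    Ψ≋chainsFrom w = ∑-filter isChain? (concatMap tuples (upTo (suc m))) _

    -- A chain either jumps straight to `1̂` or is split at its first interior element `r`; what
    -- follows `r` has fewer than `N` interior elements, and linearity of the product collects it
    -- into the right factor.
    chainsFrom-suc : ∀ N p w → chainsFrom p (suc N) w ≈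
      ⟦ does (p <? 1̂) ⟧ * ((a ⊖ b) ** (ρ[ p , 1̂ ] ∸ 1)) w +
      ∑ elements (λ r → ⟦ does (p <? r) ⟧ *
        ((a ⊖ b) ** (ρ[ p , r ] ∸ 1) ⊙ b ⊙ chainsFrom r N) w)
    chainsFrom-suc N p w = begin
      ∑ (concatMap tuples (upTo (suc N))) (contribution p w)
        ≈⟨ ∑-++ (tuples 0) (concatMap tuples (applyUpTo suc N)) (contribution p w) ⟩
      (contribution p w [] + 0#) + ∑ (concatMap tuples (applyUpTo suc N)) (contribution p w)
        ≈⟨ +-cong (trans (+-identityʳ _)
                    (*-congʳ (trans (⟦⟧-∧ (does (p <? 1̂)) true) (*-identityʳ _))))
             (trans (∑-concatMap tuples (applyUpTo suc N) (contribution p w))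
               (reflexive (∑-applyUpTo-suc N (λ k → ∑ (tuples k) (contribution p w))))) ⟩
      _ + ∑ (upTo N) (λ k → ∑ (tuples (suc k)) (contribution p w))
        ≈⟨ +-congˡ (∑-cong (upTo N) λ k →
             ∑-cartesianProductWith _∷_ elements (tuples k) (contribution p w)) ⟩
      _ + ∑ (upTo N) (λ k → ∑ elements (λ r → ∑ (tuples k) (λ c → contribution p w (r ∷ c))))
        ≈⟨ +-congˡ (∑-swap (upTo N) elements _) ⟩
      _ + ∑ elements (λ r → ∑ (upTo N) (λ k → ∑ (tuples k) (λ c → contribution p w (r ∷ c))))
        ≈⟨ +-congˡ (∑-cong elements λ r →
             sym (∑-concatMap tuples (upTo N) (λ c → contribution p w (r ∷ c)))) ⟩
      _ + ∑ elements (λ r → ∑ (concatMap tuples (upTo N)) (λ c → contribution p w (r ∷ c)))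
        ≈⟨ +-congˡ (∑-cong elements first-step) ⟩
      _ ∎
      where
      contribution : Carrier → Word → List Carrier → 𝕂
      contribution p w c = ⟦ does (linked? _<?_ (p ∷ c ++ [ 1̂ ])) ⟧ * weight Q p c 1̂ w

      step : Carrier → Series
      step r = (a ⊖ b) ** (ρ[ p , r ] ∸ 1) ⊙ b

      first-step : ∀ r → ∑ (concatMap tuples (upTo N)) (λ c → contribution p w (r ∷ c)) ≈
        ⟦ does (p <? r) ⟧ * (step r ⊙ chainsFrom r N) w
      first-step r = begin
        ∑ (concatMap tuples (upTo N)) (λ c → contribution p w (r ∷ c))
          ≈⟨ ∑-cong (concatMap tuples (upTo N)) (λ c → begin
               contribution p w (r ∷ c)
                 ≈⟨ *-congʳ (⟦⟧-∧ (does (p <? r)) _) ⟩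
               ⟦ does (p <? r) ⟧ * ⟦ does (linked? _<?_ (r ∷ c ++ [ 1̂ ])) ⟧ * _
                 ≈⟨ *-assoc _ _ _ ⟩
               ⟦ does (p <? r) ⟧ * (⟦ does (linked? _<?_ (r ∷ c ++ [ 1̂ ])) ⟧ * _)
                 ≈⟨ *-congˡ (⊙-· _ (step r) (weight Q r c 1̂) w) ⟨
               ⟦ does (p <? r) ⟧ * (step r ⊙ (λ v → contribution r v c)) w ∎) ⟩
        ∑ (concatMap tuples (upTo N))
          (λ c → ⟦ does (p <? r) ⟧ * (step r ⊙ (λ v → contribution r v c)) w)
          ≈⟨ ∑-* (concatMap tuples (upTo N)) ⟦ does (p <? r) ⟧ _ ⟩
        ⟦ does (p <? r) ⟧ *
          ∑ (concatMap tuples (upTo N)) (λ c → (step r ⊙ (λ v → contribution r v c)) w)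
          ≈⟨ *-congˡ (⊙-∑ (step r) (concatMap tuples (upTo N)) (λ c v → contribution r v c) w) ⟨
        ⟦ does (p <? r) ⟧ * (step r ⊙ chainsFrom r N) w ∎

-- The linear system

module Automaton {c ℓ₁ ℓ₂} (K : HeytingField c ℓ₁ ℓ₂) {n : ℕ}
  (B : ℕ → Fin n → Fin n → HeytingField.Carrier K) (y : Fin n) where
  open SeriesRing K
  open Sums K
  open Rationality K
  open import Relation.Binary.Reasoning.Setoid setoid

  [𝐚−𝐛] [𝐛] : Letter → 𝕂
  [𝐚−𝐛] 𝐚 = 1#
  [𝐚−𝐛] 𝐛 = - 1#
  [𝐛] 𝐚 = 0#
  [𝐛] 𝐛 = 1#

  linear-⊙ : ∀ {f k l} g → Proper f → ∂ l f ≋ constant k → ∀ w → (f ⊙ g) (l ∷ w) ≈ k * g w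
  linear-⊙ {f} {k} {l} g f≈0 ∂f w = begin
    (f ⊙ g) (l ∷ w)                      ≡⟨ ⊙-∷ f g l w ⟩
    f [] * g (l ∷ w) + (∂ l f ⊙ g) w     ≈⟨ +-cong (≈0-* f≈0 _) (⊙-cong ∂f (λ _ → refl) w) ⟩
    0# + (constant k ⊙ g) w              ≈⟨ +-identityˡ _ ⟩
    (constant k ⊙ g) w                   ≈⟨ constant-⊙ k g w ⟩
    k * g w                              ∎

  b-proper : Proper b
  b-proper = refl

  a⊖b-proper : Proper (a ⊖ b)
  a⊖b-proper = -‿inverseʳ 0#

  ∂b : ∀ l → ∂ l b ≋ constant ([𝐛] l)
  ∂b 𝐚 w       = sym (zeroˡ (𝟙 w))
  ∂b 𝐛 []      = sym (*-identityˡ 1#)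
  ∂b 𝐛 (_ ∷ _) = sym (*-identityˡ 0#)

  ∂a⊖b : ∀ l → ∂ l (a ⊖ b) ≋ constant ([𝐚−𝐛] l)
  ∂a⊖b 𝐚 []      = trans (+-congˡ -0#≈0#) (trans (+-identityʳ 1#) (sym (*-identityˡ 1#)))
  ∂a⊖b 𝐚 (_ ∷ _) = trans (-‿inverseʳ 0#) (sym (*-identityˡ 0#))
  ∂a⊖b 𝐛 []      = trans (+-identityˡ _) (sym (*-identityʳ _))
  ∂a⊖b 𝐛 (_ ∷ _) = trans (-‿inverseʳ 0#) (sym (zeroʳ _))

  b-⊙ : ∀ g l w → (b ⊙ g) (l ∷ w) ≈ [𝐛] l * g w
  b-⊙ g l = linear-⊙ g b-proper (∂b l)

  a⊖b-⊙ : ∀ g l w → ((a ⊖ b) ⊙ g) (l ∷ w) ≈ [𝐚−𝐛] l * g w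
  a⊖b-⊙ g l = linear-⊙ g a⊖b-proper (∂a⊖b l)

  -- Recursion on the word makes questions of convergence disappear. The first letter comes either
  -- from a factor `a ⊖ b`, when the first jump exceeds k + 1 levels, or from the `b` at an interior
  -- vertex `z` reached after exactly k + 1 levels.
  Φ : ℕ → Fin n → Series
  Φ k x []      = B k x y
  Φ k x (l ∷ w) = [𝐚−𝐛] l * Φ (suc k) x w + [𝐛] l * ∑ (allFin n) (λ z → B k x z * Φ 0 z w)

  -- The chains whose first jump has exactly k + 1 levels: it ends at `y`, or continues from `z`
  -- after a factor `b`.
  landing : ℕ → Fin n → Series
  landing k x = constant (B k x y) ⊕ λ w → ∑ (allFin n) (λ z → ((constant (B k x z) ⊙ b) ⊙ Φ 0 z) w)

  Φ-unfold : ∀ k x → Φ k x ≋ landing k x ⊕ (a ⊖ b) ⊙ Φ (suc k) x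
  Φ-unfold k x [] = sym (begin
    (B k x y * 1# + ∑ (allFin n) (λ z → ((constant (B k x z) ⊙ b) ⊙ Φ 0 z) []))
      + ((a ⊖ b) ⊙ Φ (suc k) x) []
      ≈⟨ +-cong (+-cong (*-identityʳ _) (∑-0 (allFin n) λ z →
           proper-⊙ (constant (B k x z) ⊙ b) (Φ 0 z) (⊙-proper (constant (B k x z)) b b-proper)))
           (proper-⊙ (a ⊖ b) (Φ (suc k) x) a⊖b-proper) ⟩
    (B k x y + 0#) + 0#   ≈⟨ trans (+-identityʳ _) (+-identityʳ _) ⟩
    B k x y ∎)
  Φ-unfold k x (l ∷ w) = sym (begin
    (B k x y * 0# + ∑ (allFin n) (λ z → ((constant (B k x z) ⊙ b) ⊙ Φ 0 z) (l ∷ w)))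
      + ((a ⊖ b) ⊙ Φ (suc k) x) (l ∷ w)
      ≈⟨ +-cong (trans (+-congʳ (zeroʳ _)) (+-identityˡ _)) (a⊖b-⊙ (Φ (suc k) x) l w) ⟩
    ∑ (allFin n) (λ z → ((constant (B k x z) ⊙ b) ⊙ Φ 0 z) (l ∷ w)) + [𝐚−𝐛] l * Φ (suc k) x w
      ≈⟨ +-comm _ _ ⟩
    [𝐚−𝐛] l * Φ (suc k) x w + ∑ (allFin n) (λ z → ((constant (B k x z) ⊙ b) ⊙ Φ 0 z) (l ∷ w))
      ≈⟨ +-congˡ (∑-cong (allFin n) λ z → begin
           ((constant (B k x z) ⊙ b) ⊙ Φ 0 z) (l ∷ w)
             ≈⟨ ⊙-assoc (constant (B k x z)) b (Φ 0 z) (l ∷ w) ⟩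
           (constant (B k x z) ⊙ (b ⊙ Φ 0 z)) (l ∷ w)
             ≈⟨ constant-⊙ (B k x z) (b ⊙ Φ 0 z) (l ∷ w) ⟩
           B k x z * (b ⊙ Φ 0 z) (l ∷ w)
             ≈⟨ *-congˡ (b-⊙ (Φ 0 z) l w) ⟩
           B k x z * ([𝐛] l * Φ 0 z w)
             ≈⟨ x∙yz≈y∙xz _ _ _ ⟩
           [𝐛] l * (B k x z * Φ 0 z w) ∎) ⟩
    [𝐚−𝐛] l * Φ (suc k) x w + ∑ (allFin n) (λ z → [𝐛] l * (B k x z * Φ 0 z w))
      ≈⟨ +-congˡ (∑-* (allFin n) ([𝐛] l) _) ⟩
    [𝐚−𝐛] l * Φ (suc k) x w + [𝐛] l * ∑ (allFin n) (λ z → B k x z * Φ 0 z w) ∎)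

  -- Whole tails are compared, since `Φ i` reads `B` at every index from i on.
  Agree : ℕ → ℕ → Set ℓ₁
  Agree i j = ∀ k u v → B (k ℕ.+ i) u v ≈ B (k ℕ.+ j) u v

  Φ-agree : ∀ {i j} → Agree i j → ∀ k x → Φ (k ℕ.+ i) x ≋ Φ (k ℕ.+ j) x
  Φ-agree agree k x []      = agree k x y
  Φ-agree agree k x (l ∷ w) = +-cong
    (*-congˡ (Φ-agree agree (suc k) x w))
    (*-congˡ (∑-cong (allFin n) λ z → *-congʳ (agree k x z)))

  letter-rational : ∀ {f} → (∀ l l′ w → f (l ∷ l′ ∷ w) ≈ 0#) → IsRational f
  letter-rational f≈0 = polynomial ([] ∷ (𝐚 ∷ []) ∷ (𝐛 ∷ []) ∷ [] , λ
    { []          ∉ → ⊥-elim (∉ (here ≡.refl))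
    ; (𝐚 ∷ [])    ∉ → ⊥-elim (∉ (there (here ≡.refl)))
    ; (𝐛 ∷ [])    ∉ → ⊥-elim (∉ (there (there (here ≡.refl))))
    ; (l ∷ l′ ∷ w) _ → f≈0 l l′ w
    })

  a-vanishes : ∀ l l′ w → a (l ∷ l′ ∷ w) ≡ 0#
  a-vanishes 𝐚 l′ w = ≡.refl
  a-vanishes 𝐛 l′ w = ≡.refl

  b-vanishes : ∀ l l′ w → b (l ∷ l′ ∷ w) ≡ 0#
  b-vanishes 𝐚 l′ w = ≡.refl
  b-vanishes 𝐛 l′ w = ≡.refl

  b-rational : IsRational b
  b-rational = letter-rational λ l l′ w → reflexive (b-vanishes l l′ w)

  a⊖b-rational : IsRational (a ⊖ b)
  a⊖b-rational = plus (letter-rational λ l l′ w → reflexive (a-vanishes l l′ w))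
                      (⊝-rational b-rational)

  ∑-affine : ∀ {m} {G : Fin m → Series} {A : Set} (xs : List A) {f : A → Series} →
             (∀ x → Affine G (f x)) → Affine G (λ w → ∑ xs (λ x → f x w))
  ∑-affine []       af = const 𝟘-rational
  ∑-affine (x ∷ xs) af = sum (af x) (∑-affine xs af)

  landing-affine : ∀ k x → Affine (Φ 0) (landing k x)
  landing-affine k x = sum (const (constant-rational (B k x y)))
    (∑-affine (allFin n) λ z → term (times (constant-rational (B k x z)) b-rational)
      (⊙-proper (constant (B k x z)) b b-proper) z)

  Φ-suc-affine : ∀ {k x} → Affine (Φ 0) (Φ (suc k) x) → Affine (Φ 0) (Φ k x)
  Φ-suc-affine {k} {x} af = affine-respects (λ w → sym (Φ-unfold k x w))
    (sum (landing-affine k x) (scale a⊖b-rational af))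

  -- `Φ-unfold` iterated d + 1 times: `p` is the product of d + 1 factors `a ⊖ b`, and `g` collects
  -- the landings passed on the way.
  Φ-relation : ∀ d k x → ∃[ p ] ∃[ g ] IsRational p × Proper p × Affine (Φ 0) g ×
               Φ k x ≋ g ⊕ p ⊙ Φ (suc d ℕ.+ k) x
  Φ-relation zero k x =
    a ⊖ b , _ , a⊖b-rational , a⊖b-proper , landing-affine k x , Φ-unfold k x
  Φ-relation (suc d) k x
    with p , g , rp , p≈0 , ag , Φ≋ ← Φ-relation d k x =
    p ⊙ (a ⊖ b) , g ⊕ p ⊙ h , times rp a⊖b-rational , proper-⊙ p (a ⊖ b) p≈0 ,
    sum ag (scale rp (landing-affine j x)) , λ w → begin
      Φ k x w
        ≈⟨ Φ≋ w ⟩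
      g w + (p ⊙ Φ j x) w
        ≈⟨ +-congˡ (⊙-cong {p} (λ _ → refl) (Φ-unfold j x) w) ⟩
      g w + (p ⊙ (h ⊕ (a ⊖ b) ⊙ Φ (suc j) x)) w
        ≈⟨ +-congˡ (⊙-distribˡ-⊕ p h ((a ⊖ b) ⊙ Φ (suc j) x) w) ⟩
      g w + ((p ⊙ h) w + (p ⊙ ((a ⊖ b) ⊙ Φ (suc j) x)) w)
        ≈⟨ +-assoc _ _ _ ⟨
      g w + (p ⊙ h) w + (p ⊙ ((a ⊖ b) ⊙ Φ (suc j) x)) w
        ≈⟨ +-congˡ (⊙-assoc p (a ⊖ b) (Φ (suc j) x) w) ⟨
      g w + (p ⊙ h) w + (p ⊙ (a ⊖ b) ⊙ Φ (suc j) x) w ∎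
    where
    j = suc d ℕ.+ k
    h = landing j x

  -- Periodicity turns the relation between levels i and d + 1 + i into a fixpoint equation for
  -- `Φ i x`. Solving it and descending to level 0 leaves a finite system in the unknowns `Φ 0 z`
  -- alone.
  Φ-rational : ∀ {i d} → Agree (suc d ℕ.+ i) i → ∀ x → IsRational (Φ 0 x)
  Φ-rational {i} {d} agree x = affine⇒rational (descend i ∘ affineᵢ) (descend i (affineᵢ x))
    where
    affineᵢ : ∀ x → Affine (Φ 0) (Φ i x)
    affineᵢ x with p , g , rp , p≈0 , ag , Φ≋ ← Φ-relation d i x =
      affine-fixpoint rp p≈0 ag λ w → trans (Φ≋ w)
        (+-congˡ (⊙-cong {p} (λ _ → refl) (Φ-agree agree 0 x) w))
    descend : ∀ k {x} → Affine (Φ 0) (Φ k x) → Affine (Φ 0) (Φ 0 x)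
    descend zero    af = af
    descend (suc k) af = descend k (Φ-suc-affine af)

  -- H z j plays the chains that continue from z after a first jump of k + j + 1
  -- levels; it may differ from Φ 0 z in other degrees or where no such jump exists.
  first-jump : ∀ k u w (H : Fin n → ℕ → Series) →
    (∀ z j v → suc (j ℕ.+ length v) ≡ length w →
      B (k ℕ.+ j) u z * H z j v ≈ B (k ℕ.+ j) u z * Φ 0 z v) →
    B (k ℕ.+ length w) u y * ((a ⊖ b) ** length w) w +
      ∑ (allFin n) (λ z → ∑ (upTo (suc (length w)))
        (λ j → B (k ℕ.+ j) u z * ((a ⊖ b) ** j ⊙ b ⊙ H z j) w))
    ≈ Φ k u w
  first-jump k u [] H H≈Φ rewrite ℕ.+-identityʳ k =
    trans (+-cong (*-identityʳ _) (∑-0 (allFin n) λ z → 0+0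
      (*-≈0 _ (proper-⊙ (𝟙 ⊙ b) (H z 0) (⊙-proper 𝟙 b b-proper))) refl))
      (+-identityʳ _)
  first-jump k u (l ∷ w) H H≈Φ = begin
    B (k ℕ.+ suc (length w)) u y * ((a ⊖ b) ⊙ (a ⊖ b) ** length w) (l ∷ w) +
      ∑ (allFin n) (λ z → ∑ (upTo (suc (suc (length w)))) (body z))
      ≈⟨ +-cong
           (trans (*-cong (reflexive (≡.cong (λ i → B i u y) (ℕ.+-suc k (length w))))
                          (a⊖b-⊙ ((a ⊖ b) ** length w) l w))
                  (x∙yz≈y∙xz _ _ _))
           -- The leading factor is `b` for j = 0 and `a ⊖ b` for j > 0; splitting off j = 0
           -- separates the two summands of `Φ` at `l ∷ w`.
           (∑-cong (allFin n) λ z → trans (reflexive (∑-upTo-suc (suc (length w)) (body z)))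
             (+-cong (body-zero z) (trans (∑-cong (upTo (suc (length w))) (body-suc z))
                                          (∑-* (upTo (suc (length w))) ([𝐚−𝐛] l) (body′ z))))) ⟩
    [𝐚−𝐛] l * (B (suc k ℕ.+ length w) u y * ((a ⊖ b) ** length w) w) +
      ∑ (allFin n) (λ z → [𝐛] l * (B k u z * Φ 0 z w) +
        [𝐚−𝐛] l * ∑ (upTo (suc (length w))) (body′ z))
      ≈⟨ +-congˡ (trans (∑-+ (allFin n) _ _)
           (trans (+-cong (∑-* (allFin n) ([𝐛] l) _) (∑-* (allFin n) ([𝐚−𝐛] l) _)) (+-comm _ _))) ⟩
    [𝐚−𝐛] l * (B (suc k ℕ.+ length w) u y * ((a ⊖ b) ** length w) w) +
      ([𝐚−𝐛] l * ∑ (allFin n) (λ z → ∑ (upTo (suc (length w))) (body′ z)) +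
       [𝐛] l * ∑ (allFin n) (λ z → B k u z * Φ 0 z w))
      ≈⟨ trans (sym (+-assoc _ _ _)) (+-congʳ (sym (distribˡ ([𝐚−𝐛] l) _ _))) ⟩
    [𝐚−𝐛] l * (B (suc k ℕ.+ length w) u y * ((a ⊖ b) ** length w) w +
             ∑ (allFin n) (λ z → ∑ (upTo (suc (length w))) (body′ z))) +
      [𝐛] l * ∑ (allFin n) (λ z → B k u z * Φ 0 z w)
      -- One factor `a ⊖ b` has been consumed, so the recursion continues at level `suc k` with `H`
      -- shifted by one.
      ≈⟨ +-congʳ (*-congˡ (first-jump (suc k) u w (λ z j → H z (suc j)) H≈Φ′)) ⟩
    [𝐚−𝐛] l * Φ (suc k) u w + [𝐛] l * ∑ (allFin n) (λ z → B k u z * Φ 0 z w) ∎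
    where
    body body′ : Fin n → ℕ → 𝕂
    body  z j = B (k ℕ.+ j) u z * ((a ⊖ b) ** j ⊙ b ⊙ H z j) (l ∷ w)
    body′ z j = B (suc k ℕ.+ j) u z * ((a ⊖ b) ** j ⊙ b ⊙ H z (suc j)) w

    H≈Φ′ : ∀ z j v → suc (j ℕ.+ length v) ≡ length w →
      B (suc k ℕ.+ j) u z * H z (suc j) v ≈ B (suc k ℕ.+ j) u z * Φ 0 z v
    H≈Φ′ z j v eq = ≡.subst (λ i → B i u z * H z (suc j) v ≈ B i u z * Φ 0 z v)
      (ℕ.+-suc k j) (H≈Φ z (suc j) v (≡.cong suc eq))

    body-zero : ∀ z → body z 0 ≈ [𝐛] l * (B k u z * Φ 0 z w)
    body-zero z = begin
      B (k ℕ.+ 0) u z * (𝟙 ⊙ b ⊙ H z 0) (l ∷ w)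
        ≈⟨ *-congˡ (⊙-cong {g = H z 0} (𝟙-⊙ b) (λ _ → refl) (l ∷ w)) ⟩
      B (k ℕ.+ 0) u z * (b ⊙ H z 0) (l ∷ w)
        ≈⟨ *-congˡ (b-⊙ (H z 0) l w) ⟩
      B (k ℕ.+ 0) u z * ([𝐛] l * H z 0 w)
        ≈⟨ x∙yz≈y∙xz _ _ _ ⟩
      [𝐛] l * (B (k ℕ.+ 0) u z * H z 0 w)
        ≈⟨ *-congˡ (H≈Φ z 0 w ≡.refl) ⟩
      [𝐛] l * (B (k ℕ.+ 0) u z * Φ 0 z w)
        ≡⟨ ≡.cong (λ i → [𝐛] l * (B i u z * Φ 0 z w)) (ℕ.+-identityʳ k) ⟩
      [𝐛] l * (B k u z * Φ 0 z w) ∎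

    body-suc : ∀ z j → body z (suc j) ≈ [𝐚−𝐛] l * body′ z j
    body-suc z j = begin
      B (k ℕ.+ suc j) u z * (((a ⊖ b) ⊙ (a ⊖ b) ** j) ⊙ b ⊙ H z (suc j)) (l ∷ w)
        ≡⟨ ≡.cong (λ i → B i u z * (((a ⊖ b) ⊙ (a ⊖ b) ** j) ⊙ b ⊙ H z (suc j)) (l ∷ w))
             (ℕ.+-suc k j) ⟩
      B (suc k ℕ.+ j) u z * (((a ⊖ b) ⊙ (a ⊖ b) ** j) ⊙ b ⊙ H z (suc j)) (l ∷ w)
        ≈⟨ *-congˡ (⊙-cong {g = H z (suc j)} (⊙-assoc (a ⊖ b) ((a ⊖ b) ** j) b)
             (λ _ → refl) (l ∷ w)) ⟩
      B (suc k ℕ.+ j) u z * ((a ⊖ b) ⊙ ((a ⊖ b) ** j ⊙ b) ⊙ H z (suc j)) (l ∷ w)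
        ≈⟨ *-congˡ (⊙-assoc (a ⊖ b) ((a ⊖ b) ** j ⊙ b) (H z (suc j)) (l ∷ w)) ⟩
      B (suc k ℕ.+ j) u z * ((a ⊖ b) ⊙ ((a ⊖ b) ** j ⊙ b ⊙ H z (suc j))) (l ∷ w)
        ≈⟨ *-congˡ (a⊖b-⊙ ((a ⊖ b) ** j ⊙ b ⊙ H z (suc j)) l w) ⟩
      B (suc k ℕ.+ j) u z * ([𝐚−𝐛] l * ((a ⊖ b) ** j ⊙ b ⊙ H z (suc j)) w)
        ≈⟨ x∙yz≈y∙xz _ _ _ ⟩
      [𝐚−𝐛] l * body′ z j ∎

-- Level posets

module Supports {n : ℕ} (M : Matrix n) where
  open LevelPoset M

  infix 4 _⊑_
  _⊑_ : Matrix n → Matrix n → Set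
  A ⊑ B = ∀ u v → 0 ℕ.< A u v → 0 ℕ.< B u v

  -- Positivity of an entry of a product depends only on the supports of the factors, so inclusions
  -- of supports survive multiplication by powers of `M`.
  ⊑-step : ∀ {i j} k → M ^ i ⊑ M ^ j → M ^ (k ℕ.+ i) ⊑ M ^ (k ℕ.+ j)
  ⊑-step zero    i⊑j u v p = i⊑j u v p
  ⊑-step (suc k) i⊑j u v p
    with t , q , r ← ^-step⁻ (k ℕ.+ _) p = ^-step (k ℕ.+ _) t q (⊑-step k i⊑j t v r)

  sign : ℕ → Fin 2
  sign zero    = fzero
  sign (suc _) = fsuc fzero

  sign-pos : ∀ {i j} → sign i ≡ sign j → 0 ℕ.< i → 0 ℕ.< j
  sign-pos {suc i} {suc j} _ _ = z<s

  -- The support as an element of a finite set, one bit per entry, ready for the pigeonhole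
  -- principle.
  code : Matrix n → Fin ((2 ℕ.^ n) ℕ.^ n)
  code A = funToFin (λ u → funToFin (λ v → sign (A u v)))

  code-⊑ : ∀ {A B} → code A ≡ code B → A ⊑ B
  code-⊑ {A} {B} eq u v = sign-pos
    (≡.trans (≡.sym (decode A)) (≡.trans
      (≡.cong (λ c → finToFun (finToFun {2 ℕ.^ n} {n} c u) v) eq) (decode B)))
    where
    decode : ∀ A → finToFun (finToFun {2 ℕ.^ n} {n} (code A) u) v ≡ sign (A u v)
    decode A = ≡.trans
      (≡.cong (λ c → finToFun c v) (Fin.finToFun-funToFin (λ u → funToFin (λ v → sign (A u v))) u))
      (Fin.finToFun-funToFin (λ v → sign (A u v)) v)

  -- Two of the first (2^n)^n + 1 powers share a support; writing the larger exponent as 1 + d + i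
  -- makes the period positive.
  supports-periodic : ∃[ i ] ∃[ d ] M ^ i ⊑ M ^ (suc d ℕ.+ i) × M ^ (suc d ℕ.+ i) ⊑ M ^ i
  supports-periodic
    with i , j , i<j , eq ← Fin.pigeonhole (ℕ.n<1+n _) (λ k → code (M ^ toℕ k))
    with d , j≡ ← ℕ.m≤n⇒∃[o]m+o≡n i<j =
    toℕ i , d , code-⊑ eq′ , code-⊑ (≡.sym eq′)
    where
    eq′ : code (M ^ toℕ i) ≡ code (M ^ (suc d ℕ.+ toℕ i))
    eq′ = ≡.trans eq (≡.cong (λ k → code (M ^ k))
            (≡.trans (≡.sym j≡) (≡.cong suc (ℕ.+-comm (toℕ i) d))))

-- Identification of the series of a level poset with the solution of the system

module _ {c ℓ₁ ℓ₂} (K : HeytingField c ℓ₁ ℓ₂) {n : ℕ} (M : Matrix n) (y : Fin n) where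
  open SeriesRing K
  open Sums K
  open LevelPoset M
  open Supports M using (⊑-step; supports-periodic)
  open import Relation.Binary.Reasoning.Setoid setoid

  walk? : ∀ k u v → Dec (0 ℕ.< (M ^ suc k) u v)
  walk? k u v = 0 ℕ.<? (M ^ suc k) u v

  -- The index is one less than the jump, matching the weight: a jump of k + 1 levels contributes (a
  -- - b)^k.
  B : ℕ → Fin n → Fin n → 𝕂
  B k u v = ⟦ does (walk? k u v) ⟧

  open Automaton K B y

  B≈0 : ∀ k u v → ¬ 0 ℕ.< (M ^ suc k) u v → B k u v ≈ 0#
  B≈0 k u v ¬p = reflexive (≡.cong ⟦_⟧ (dec-false (walk? k u v) ¬p))

  Φ₀-rational : ∀ x → IsRational (Φ 0 x)
  Φ₀-rational with i , d , i⊑j , j⊑i ← supports-periodic =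
    Φ-rational {i} {d} λ k u v → reflexive (≡.cong ⟦_⟧
      (does-⇔ (mk⇔ (⊑-step (suc k) j⊑i u v) (⊑-step (suc k) i⊑j u v))
        (walk? (k ℕ.+ (suc d ℕ.+ i)) u v) (walk? (k ℕ.+ i) u v)))

  -- Every contribution yields a walk of k + |w| + 1 steps from `z` to `y`: a first jump to `t` and
  -- a walk from `t` compose by `^-trans`.
  Φ-vanishes : ∀ k z w → ¬ 0 ℕ.< (M ^ suc (k ℕ.+ length w)) z y → Φ k z w ≈ 0#
  Φ-vanishes k z [] ¬p rewrite ℕ.+-identityʳ k = B≈0 k z y ¬p
  Φ-vanishes k z (l ∷ w) ¬p = 0+0
    (*-≈0 _ (Φ-vanishes (suc k) z w
      (≡.subst (λ i → ¬ 0 ℕ.< (M ^ suc i) z y) (ℕ.+-suc k (length w)) ¬p)))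
    (*-≈0 _ (∑-0 (allFin n) λ t → via t (walk? k z t)))
    where
    via : ∀ t → Dec (0 ℕ.< (M ^ suc k) z t) → B k z t * Φ 0 t w ≈ 0#
    via t (no ¬q) = ≈0-* (B≈0 k z t ¬q) _
    via t (yes q) = *-≈0 _ (Φ-vanishes 0 t w λ r → ¬p (^-trans (suc k) (suc (length w)) q r))

  ∣1+i+k-i∣ : ∀ i k → ∣ + suc (i ℕ.+ k) ℤ.- + i ∣ ≡ suc k
  ∣1+i+k-i∣ i k = ≡.trans (≡.cong (λ j → ∣ + j ℤ.- + i ∣) (≡.sym (ℕ.+-suc i k)))
                          (∣i+k-i∣ (+ i) (suc k))

  <⇒walk : ∀ i k {u v} → (u , + i) < (v , + suc (i ℕ.+ k)) → 0 ℕ.< (M ^ suc k) u v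
  <⇒walk i k {u} {v} (_ , p) = ≡.subst (λ j → 0 ℕ.< (M ^ j) u v) (∣1+i+k-i∣ i k) p

  walk⇒< : ∀ i k {u v} → 0 ℕ.< (M ^ suc k) u v → (u , + i) < (v , + suc (i ℕ.+ k))
  walk⇒< i k {u} {v} p = ℤ.+<+ (s≤s (ℕ.m≤m+n i k)) ,
    ≡.subst (λ j → 0 ℕ.< (M ^ j) u v) (≡.sym (∣1+i+k-i∣ i k)) p

  does-<≡does-walk : ∀ i k {u v} →
    does ((u , + i) <? (v , + suc (i ℕ.+ k))) ≡ does (walk? k u v)
  does-<≡does-walk i k {u} {v} = does-⇔ (mk⇔ (<⇒walk i k) (walk⇒< i k))
    ((u , + i) <? (v , + suc (i ℕ.+ k))) (walk? k u v)

  module _ (x : Fin n) (m : ℕ) (b<t : bottom x y m < top x y m) where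
    Q : FiniteGradedPoset m
    Q = interval x y m b<t

    -- Induction on `N`, along the first jump. By i + |w| = m, the word has the degree of the chains
    -- from level i to level m + 1; |w| < N leaves room for all of them, as at most |w| ranks lie in
    -- between.
    chainsFrom≈Φ : ∀ N u i w → bottom x y m ≤ (u , + i) → i ℕ.+ length w ≡ m →
                   length w ℕ.< N → chainsFrom Q (u , + i) N w ≈ Φ 0 u w
    chainsFrom≈Φ (suc N) u i w b≤p ≡.refl (s≤s w≤N) = begin
      chainsFrom Q (u , + i) (suc N) w
        ≈⟨ chainsFrom-suc Q N (u , + i) w ⟩
      ⟦ does ((u , + i) <? (y , + suc (i ℕ.+ length w))) ⟧ *
        ((a ⊖ b) ** (∣ + suc (i ℕ.+ length w) ℤ.- + i ∣ ∸ 1)) w +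
      ∑ (intervalElements x y m) jump
        ≡⟨ ≡.cong₂ (λ t k → ⟦ t ⟧ * ((a ⊖ b) ** (k ∸ 1)) w + ∑ (intervalElements x y m) jump)
             (does-<≡does-walk i (length w)) (∣1+i+k-i∣ i (length w)) ⟩
      B (length w) u y * ((a ⊖ b) ** length w) w + ∑ (intervalElements x y m) jump
        ≈⟨ +-congˡ (begin
             ∑ (intervalElements x y m) jump
               ≈⟨ ∑-filter (between? x y m) (candidates x y m) jump ⟩
             ∑ (candidates x y m) jump′
               ≈⟨ ∑-cartesianProductWith _,_ (allFin n) (map +_ (upTo (suc (suc m)))) jump′ ⟩
             ∑ (allFin n) (λ z → ∑ (map +_ (upTo (suc (suc m)))) (λ k → jump′ (z , k)))
               ≈⟨ ∑-cong (allFin n) (λ z → begin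
                    ∑ (map +_ (upTo (suc (suc m)))) (λ k → jump′ (z , k))
                      ≡⟨ ∑-map +_ (upTo (suc (suc m))) (λ k → jump′ (z , k)) ⟩
                    ∑ (upTo (suc (suc m))) (λ k → jump′ (z , + k))
                      ≡⟨ ≡.cong (λ l → ∑ (upTo (suc l)) (λ k → jump′ (z , + k)))
                           (ℕ.+-suc i (length w)) ⟨
                    ∑ (upTo (suc i ℕ.+ suc (length w))) (λ k → jump′ (z , + k))
                      -- Jumps go strictly up, so levels 0 to i contribute nothing; |w| + 1 levels
                      -- remain, from i + 1 to m + 1.
                      ≈⟨ ∑-drop (suc i) (suc (length w)) (λ k → jump′ (z , + k)) (jump′-below z) ⟩
                    ∑ (upTo (suc (length w))) (λ j → jump′ (z , + suc (i ℕ.+ j)))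
                      ≈⟨ ∑-cong (upTo (suc (length w))) (jump′≈ z) ⟩
                    ∑ (upTo (suc (length w))) (λ j → B j u z * ((a ⊖ b) ** j ⊙ b ⊙ H z j) w) ∎) ⟩
             ∑ (allFin n) (λ z → ∑ (upTo (suc (length w)))
               (λ j → B j u z * ((a ⊖ b) ** j ⊙ b ⊙ H z j) w)) ∎) ⟩
      B (length w) u y * ((a ⊖ b) ** length w) w +
        ∑ (allFin n) (λ z → ∑ (upTo (suc (length w)))
          (λ j → B j u z * ((a ⊖ b) ** j ⊙ b ⊙ H z j) w))
        ≈⟨ first-jump 0 u w H H≈Φ ⟩
      Φ 0 u w ∎
      where
      jump jump′ : Element → 𝕂
      jump r = ⟦ does ((u , + i) <? r) ⟧ *
        ((a ⊖ b) ** (∣ proj₂ r ℤ.- + i ∣ ∸ 1) ⊙ b ⊙ chainsFrom Q r N) w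
      jump′ r = ⟦ does (between? x y m r) ⟧ * jump r

      -- The test for membership in the interval is absorbed into the continuation, to fit the shape
      -- of `first-jump`.
      H : Fin n → ℕ → Series
      H z j = ⟦ does (between? x y m (z , + suc (i ℕ.+ j))) ⟧ · chainsFrom Q (z , + suc (i ℕ.+ j)) N

      jump′-below : ∀ z k → k ℕ.< suc i → jump′ (z , + k) ≈ 0#
      jump′-below z k (s≤s k≤i) = *-≈0 _ (≈0-* (reflexive (≡.cong ⟦_⟧
        (dec-false ((u , + i) <? (z , + k)) λ (i<k , _) → ℕ.<⇒≱ (ℤ.drop‿+<+ i<k) k≤i))) _)

      jump′≈ : ∀ z j → jump′ (z , + suc (i ℕ.+ j)) ≈ B j u z * ((a ⊖ b) ** j ⊙ b ⊙ H z j) w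
      jump′≈ z j = begin
        jump′ r
          ≡⟨ ≡.cong₂ (λ t k → β * (⟦ t ⟧ * ((a ⊖ b) ** (k ∸ 1) ⊙ b ⊙ chainsFrom Q r N) w))
               (does-<≡does-walk i j) (∣1+i+k-i∣ i j) ⟩
        β * (B j u z * ((a ⊖ b) ** j ⊙ b ⊙ chainsFrom Q r N) w)
          ≈⟨ x∙yz≈y∙xz _ _ _ ⟩
        B j u z * (β * ((a ⊖ b) ** j ⊙ b ⊙ chainsFrom Q r N) w)
          ≈⟨ *-congˡ (⊙-· β ((a ⊖ b) ** j ⊙ b) (chainsFrom Q r N) w) ⟨
        B j u z * ((a ⊖ b) ** j ⊙ b ⊙ H z j) w ∎
        where
        r = z , + suc (i ℕ.+ j)
        β = ⟦ does (between? x y m r) ⟧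

      H≈Φ : ∀ z j v → suc (j ℕ.+ length v) ≡ length w → B j u z * H z j v ≈ B j u z * Φ 0 z v
      H≈Φ z j v eq with walk? j u z
      ... | no ¬p = trans (≈0-* (B≈0 j u z ¬p) _) (sym (≈0-* (B≈0 j u z ¬p) _))
      ... | yes p = *-congˡ (by-cases (between? x y m r))
        where
        r = z , + suc (i ℕ.+ j)

        level : suc (i ℕ.+ j) ℕ.+ length v ≡ m
        level = ≡.trans (≡.cong suc (ℕ.+-assoc i j (length v)))
          (≡.trans (≡.sym (ℕ.+-suc i (j ℕ.+ length v))) (≡.cong (i ℕ.+_) eq))

        b≤r : bottom x y m ≤ r
        b≤r = inj₁ (≤-<-tr b≤p (walk⇒< i j p))

        by-cases : (β : Dec (bottom x y m ≤ r × r ≤ top x y m)) →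
                   ⟦ does β ⟧ * chainsFrom Q r N v ≈ Φ 0 z v
        by-cases (yes _) = trans (*-identityˡ _)
          (chainsFrom≈Φ N z (suc (i ℕ.+ j)) v b≤r level
            (ℕ.<-≤-trans (ℕ.≤-trans (s≤s (ℕ.m≤n+m (length v) j)) (ℕ.≤-reflexive eq)) w≤N))
        -- Here `r` is above the bottom but not below the top, so no walk from `z` reaches `y` in
        -- the remaining levels and `Φ` vanishes too.
        by-cases (no ¬between) = trans (zeroˡ _) (sym (Φ-vanishes 0 z v λ q →
          ¬between (b≤r , inj₁ (≡.subst (λ k → r < (y , + suc k)) level
            (walk⇒< (suc (i ℕ.+ j)) (length v) q)))))

  -- For m = |w|, the bound `suc m` in the list of chains is just the room that `chainsFrom≈Φ` asks
  -- for. If bottom and top are incomparable, both sides are 0.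
  Ψ[length]≈Φ : ∀ x w → Ψ[_] M x y (length w) w ≈ Φ 0 x w
  Ψ[length]≈Φ x w with bottom x y (length w) <? top x y (length w)
  ... | yes b<t = trans (Ψ≋chainsFrom (interval x y (length w) b<t) w)
    (chainsFrom≈Φ x (length w) b<t (suc (length w)) x 0 w (inj₂ ≡.refl) ≡.refl (ℕ.n<1+n _))
  ... | no b≮t = sym (Φ-vanishes 0 x w λ p → b≮t (walk⇒< 0 (length w) p))

  Ψ[]-homogeneous : ∀ x m → Homogeneous m (Ψ[_] M x y m)
  Ψ[]-homogeneous x m w w≢m with bottom x y m <? top x y m
  ... | yes b<t = Ψ-homogeneous (interval x y m b<t) w w≢m
  ... | no  _   = refl

  -- By homogeneity, among the summands m = 0, ..., |w| only the last one can be nonzero at `w`.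
  abSeries≋Φ : ∀ x → abSeries M x y ≋ Φ 0 x
  abSeries≋Φ x w = begin
    ∑ (upTo (suc (length w))) (λ m → Ψ[_] M x y m w)
      ≡⟨ ≡.cong (λ k → ∑ (upTo k) (λ m → Ψ[_] M x y m w)) (ℕ.+-comm (length w) 1) ⟨
    ∑ (upTo (length w ℕ.+ 1)) (λ m → Ψ[_] M x y m w)
      ≈⟨ ∑-drop (length w) 1 _ (λ m m<w → Ψ[]-homogeneous x m w (≡.≢-sym (ℕ.<⇒≢ m<w))) ⟩
    Ψ[_] M x y (length w ℕ.+ 0) w + 0#
      ≈⟨ +-identityʳ _ ⟩
    Ψ[_] M x y (length w ℕ.+ 0) w
      ≡⟨ ≡.cong (λ k → Ψ[_] M x y k w) (ℕ.+-identityʳ (length w)) ⟩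
    Ψ[_] M x y (length w) w
      ≈⟨ Ψ[length]≈Φ x w ⟩
    Φ 0 x w ∎

theorem7p3 : ∀ {c ℓ₁ ℓ₂} (K : HeytingField c ℓ₁ ℓ₂) (n : ℕ) (M : Matrix n) →
    IsZeroOne M → (x y : Fin n) →
    PowerSeries.IsRational K (PowerSeries.abSeries K M x y)
theorem7p3 K n M _ x y = PowerSeries.respects
  (λ w → SeriesRing.sym K (abSeries≋Φ K M y x w)) (Φ₀-rational K M y x)
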